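{- Let $M$ be a multigraph and let $H$ be a graph obtained from $M$ by subdividing each edge of $M$ at least $\ell$ times (different edges may be subdivided different numbers of times). If $\ell=2$ and $M$ is loopless, then $g_3(H)\leq 2$ and $h_4(H)=1$. If $\ell=3$, then $h_3(H)\leq 2$.
   Context: Subdividing an edge $t$ times replaces it (including a loop) by a path whose $t$ new internal vertices have degree $2$; such an $H$ is $3$-colorable. For a graph $H$ and an integer $k\geq\chi(H)$, a proper $k$-coloring of $H$ is a map $\phi:V(H)\to[k]$ with $\phi(u)\neq\phi(v)$ for every edge $uv$. For a positive integer $j$, $G^j_k(H)$ is the graph whose vertices are the proper $k$-colorings of $H$, two distinct colorings being adjacent if $H$ contains a connected subgraph on at most $j$ vertices containing every vertex on which the two colorings differ. $g_k(H)$ is the least positive integer $j$ such that $G^j_k(H)$ is connected, and $h_k(H)$ is the least positive integer $j$ such that $G^j_k(H)$ is Hamiltonian (complete graphs are regarded as Hamiltonian). -}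

module Defs where

open import Data.Nat using (ℕ; zero; suc; _≤_)
open import Data.Fin using (Fin; toℕ; inject₁; fromℕ) renaming (zero to fzero; suc to fsuc)
open import Data.Product using (Σ; ∃; _×_; _,_; proj₁; proj₂)
open import Data.Sum using (_⊎_)
open import Data.List using (List; length)
open import Data.List.Membership.Propositional using (_∈_)
open import Relation.Binary.PropositionalEquality using (_≡_; _≢_)
open import Relation.Nullary using (¬_)

record Graph : Set₁ where
  field
    V   : Set
    Adj : V → V → Set
open Graph public

record Multigraph : Set where
  field
    n    : ℕ
    m    : ℕ
    ends : Fin m → Fin n × Fin n
open Multigraph public

Loopless : Multigraph → Set
Loopless M = ∀ e → proj₁ (ends M e) ≢ proj₂ (ends M e)

-- Subdivision: edge e = (u , v) subdivided t e times becomes the path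
--   u — (e,0) — (e,1) — … — (e, t e - 1) — v

SubV : (M : Multigraph) → (Fin (m M) → ℕ) → Set
SubV M t = Fin (n M) ⊎ Σ (Fin (m M)) (λ e → Fin (t e))

data SubStep (M : Multigraph) (t : Fin (m M) → ℕ) : SubV M t → SubV M t → Set where
  start : ∀ e (i : Fin (t e)) → toℕ i ≡ 0 →
          SubStep M t (_⊎_.inj₁ (proj₁ (ends M e))) (_⊎_.inj₂ (e , i))
  mid   : ∀ e (i j : Fin (t e)) → suc (toℕ i) ≡ toℕ j →
          SubStep M t (_⊎_.inj₂ (e , i)) (_⊎_.inj₂ (e , j))
  end   : ∀ e (i : Fin (t e)) → suc (toℕ i) ≡ t e →
          SubStep M t (_⊎_.inj₂ (e , i)) (_⊎_.inj₁ (proj₂ (ends M e)))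

Subdivide : (M : Multigraph) → (Fin (m M) → ℕ) → Graph
Subdivide M t = record
  { V   = SubV M t
  ; Adj = λ x y → SubStep M t x y ⊎ SubStep M t y x }

Proper : (H : Graph) (k : ℕ) → (V H → Fin k) → Set
Proper H k c = ∀ u v → Adj H u v → c u ≢ c v

Colouring : Graph → ℕ → Set
Colouring H k = Σ (V H → Fin k) (Proper H k)

_≗c_ : ∀ {H k} → Colouring H k → Colouring H k → Set
_≗c_ {H} c d = ∀ (v : V H) → proj₁ c v ≡ proj₁ d v

data WalkIn (H : Graph) (S : List (V H)) : V H → V H → Set where
  here : ∀ {x} → x ∈ S → WalkIn H S x x
  step : ∀ {x y z} → x ∈ S → Adj H x y → WalkIn H S y z → WalkIn H S x z

ConnectedOn : (H : Graph) → List (V H) → Set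
ConnectedOn H S = ∀ x y → x ∈ S → y ∈ S → WalkIn H S x y

AdjG : (H : Graph) (k j : ℕ) → Colouring H k → Colouring H k → Set
AdjG H k j c d =
  (∃ λ (v : V H) → proj₁ c v ≢ proj₁ d v) ×
  (∃ λ (S : List (V H)) → length S ≤ j × ConnectedOn H S ×
       (∀ v → proj₁ c v ≢ proj₁ d v → v ∈ S))

data PathG (H : Graph) (k j : ℕ) : Colouring H k → Colouring H k → Set where
  stop : ∀ {c d} → c ≗c d → PathG H k j c d
  move : ∀ {c c' d} → AdjG H k j c c' → PathG H k j c' d → PathG H k j c d

ConnectedG : (H : Graph) (k j : ℕ) → Set
ConnectedG H k j = ∀ c d → PathG H k j c d

CompleteG : (H : Graph) (k j : ℕ) → Set
CompleteG H k j = ∀ c d → ¬ (c ≗c d) → AdjG H k j c d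

HamCycleG : (H : Graph) (k j : ℕ) → Set
HamCycleG H k j =
  Σ ℕ λ L → Σ (Fin (suc L) → Colouring H k) λ f →
    (2 ≤ L) ×
    (∀ a b → f a ≗c f b → a ≡ b) ×
    (∀ d → ∃ λ a → f a ≗c d) ×
    (∀ (i : Fin L) → AdjG H k j (f (inject₁ i)) (f (fsuc i))) ×
    AdjG H k j (f (fromℕ L)) (f fzero)

-- complete graphs are regarded as Hamiltonian
HamiltonianG : (H : Graph) (k j : ℕ) → Set
HamiltonianG H k j = CompleteG H k j ⊎ HamCycleG H k j

-- g_k(H) ≤ b  :  the least positive j with G^j_k(H) connected is ≤ b
g≤ : Graph → ℕ → ℕ → Set
g≤ H k b = ∃ λ j → 1 ≤ j × j ≤ b × ConnectedG H k j

h≤ : Graph → ℕ → ℕ → Set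
h≤ H k b = ∃ λ j → 1 ≤ j × j ≤ b × HamiltonianG H k j

-- h_k(H) = 1  (least positive j is 1, i.e. G^1_k(H) is Hamiltonian)
h≡1 : Graph → ℕ → Set
h≡1 H k = HamiltonianG H k 1

{-# OPTIONS --safe #-}
-- A colouring of H is a colouring b of V(M) together with a word of colours for every edge of M.
-- The words are built in blocks from one end: first pendant blocks, constrained only by the colour
-- next to them, then one closing block, constrained on both sides. Each block is a fibration of
-- colourings whose fibre depends only on one or two colours, and a base move lifts as long as the
-- block lies in both fibres. Since there are finitely many fibres, it remains to check finitely many
-- statements about Hamiltonian paths in them, found by a backtracking search:
--  * k = 3, connectivity: fibres are complete and neighbouring fibres meet;
--  * k = 4: for adjacent p, q in a closing fibre some Hamiltonian path from p to q uses an edge of the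
--    neighbouring fibre. Replacing that edge by a path through the rest of the space turns a
--    Hamiltonian path of the base into a Hamiltonian cycle;
--  * k = 3: the fibres are traversed one after the other, each from its entry to an exit into the next
--    fibre. The last exit must be the first entry; this is possible unless the base colours at the
--    block change there and back around the closing edge of the base cycle.

module Submission where

open import Defs
open import Data.Nat using (ℕ; zero; suc; _≤_; _<_; _+_; _*_; _∸_; _⊓_; z≤n; s≤s; s≤s⁻¹)
import Data.Nat.Properties as ℕ
open import Data.Fin using (Fin; toℕ; fromℕ; inject₁; fromℕ<) renaming (zero to fzero; suc to fsuc)
open import Data.Fin.Properties using (_≟_; toℕ<n; toℕ-fromℕ<; toℕ-injective)
open import Data.Product using (∃; ∃₂; _×_; _,_; proj₁; proj₂)
open import Data.Sum using (_⊎_; inj₁; inj₂) renaming (map to map-⊎)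
open import Data.Maybe using (Maybe; just; nothing; _<∣>_; _>>=_; zipWith; from-just)
  renaming (map to mapMaybe)
open import Data.List
  using (List; []; _∷_; _++_; map; foldr; filter; take; drop; allFin; cartesianProductWith; length)
import Data.List as List
import Data.List.Properties as List
open import Data.List.Membership.Propositional using (_∈_)
open import Data.List.Membership.Propositional.Properties
  using (∈-++⁺ˡ; ∈-++⁺ʳ; ∈-++⁻; ∈-map⁺; ∈-map⁻; ∈-allFin; ∈-filter⁺; ∈-filter⁻; ∈-lookup;
         ∈-cartesianProductWith⁺; ∈-cartesianProductWith⁻)
open import Data.List.Relation.Unary.All using ([])
import Data.List.Relation.Unary.All as All
open import Data.List.Relation.Unary.AllPairs using ([]; _∷_)
open import Data.List.Relation.Unary.Any using (here; there; index)
open import Data.List.Relation.Unary.Any.Properties using (lookup-index)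
open import Data.List.Relation.Unary.Unique.Propositional using (Unique)
import Data.List.Relation.Unary.Unique.Propositional.Properties as Unique
open import Data.List.Relation.Binary.Permutation.Propositional
  using (_↭_; refl; prep; swap; trans; ↭-sym; ↭-reflexive; ↭⇒↭ₛ; module PermutationReasoning)
open import Data.List.Relation.Binary.Permutation.Propositional.Properties
  using (∈-resp-↭; map⁺; ++⁺; ++⁺ˡ; ++-comm; shifts; ↭-length)
import Data.List.Relation.Binary.Permutation.Setoid.Properties as Permutation
open import Data.Vec using (Vec; []; _∷_; lookup)
import Data.Vec as Vec
import Data.Vec.Properties as Vec
open import Data.Unit using (⊤; tt)
open import Function using (_∘_; id)
open import Relation.Binary.Construct.Closure.ReflexiveTransitive using (Star; ε; _◅_; _◅◅_; gmap)
open import Relation.Binary.PropositionalEquality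
  using (_≡_; _≢_; refl; sym; cong; cong₂; subst; ≢-sym; setoid) renaming (trans to ≡-trans)
open import Relation.Nullary using (Dec; yes; no; ¬?; _×-dec_; contradiction)
open import Relation.Nullary.Decidable using (map′; dec⇒maybe)

private variable
  A B : Set
  R : A → A → Set

-- Hamiltonian paths and the conditions required of fibres

data Path {A : Set} (R : A → A → Set) : A → A → List A → Set where
  [_] : ∀ x → Path R x x (x ∷ [])
  _∷_ : ∀ {x y z ys} → R x y → Path R y z ys → Path R x z (x ∷ ys)

infixr 5 _∷_

Route : (A → A → Set) → List A → A → A → Set
Route R F s f = ∃ λ zs → Path R s f zs × zs ↭ F

-- A Hamiltonian path of F from f to τ whose first two edges are exposed.
record Takeoff (R : A → A → Set) (Q : A → A → A → Set) (F : List A) (f τ : A) : Set where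
  constructor takeoff
  field
    {q r}  : A
    {zs}   : List A
    f–q    : R f q
    q–r    : R q r
    path   : Path R r τ zs
    covers : f ∷ q ∷ zs ↭ F
    fits   : Q f q r

-- A Hamiltonian path of F from p to q, cut at an edge with both ends in F₁.
record Detour (R : A → A → Set) (F F₁ : List A) (p q : A) : Set where
  constructor detour
  field
    {p′ q′}   : A
    {zs ys}   : List A
    before    : Path R p p′ zs
    after     : Path R q′ q ys
    covers    : zs ++ ys ↭ F
    p′∈       : p′ ∈ F₁
    q′∈       : q′ ∈ F₁
    p′–q′     : R p′ q′

Greedy : (A → A → Set) → List A → List A → Set
Greedy R F F₁ = ∀ s → s ∈ F → ∃ λ f → Route R F s f × f ∈ F₁

Merge : (A → A → Set) → List A → List A → Set
Merge R F F₁ = ∀ p → p ∈ F → ∀ q → q ∈ F → R p q → Detour R F F₁ p q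

-- `τ` is chosen before `s`: the sweep of the other fibres starts at `τ`, and its entry `s` into the
-- last fibre `Fₗ` is known only afterwards. Whatever `s` is, the exit `f` must then lead through
-- `F₀` back to the same `τ`.
Closing : (A → A → Set) → (A → A → A → Set) → List A → List A → List A → Set
Closing R Q Fₗ F₀ F₁ = ∃ λ τ → τ ∈ F₁ ×
  (∀ s → s ∈ Fₗ → ∃ λ f → Route R Fₗ s f × Takeoff R Q F₀ f τ)

-- Backtracking search returning certified paths

first : (A → Maybe B) → List A → Maybe B
first f = foldr (λ a r → f a <∣> r) nothing

forEach : (xs : List A) {Q : A → Set} → (∀ x → x ∈ xs → Maybe (Q x)) → Maybe (∀ x → x ∈ xs → Q x)
forEach []       _ = just λ _ ()
forEach (x ∷ xs) h =
  zipWith (λ { a b _ (here refl) → a ; a b _ (there m) → b _ m })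
          (h x (here refl)) (forEach xs λ y m → h y (there m))

forFin : ∀ {k} {Q : Fin k → Set} → (∀ i → Maybe (Q i)) → Maybe (∀ i → Q i)
forFin {zero}  _ = just λ ()
forFin {suc k} h =
  zipWith (λ { a b fzero → a ; a b (fsuc i) → b i }) (h fzero) (forFin λ i → h (fsuc i))

implies : {B : Set} → Dec A → (A → Maybe B) → Maybe (A → B)
implies (yes a) h = mapMaybe (λ b _ → b) (h a)
implies (no ¬a) _ = just λ a → contradiction a ¬a

-- Every choice carries its permutation, so a path that is found comes with the proof that it covers
-- the fibre. The searches are only sound: a failure proves nothing.
selections : (xs : List A) → List (∃₂ λ y ys → y ∷ ys ↭ xs)
selections []       = []
selections (x ∷ xs) = (x , xs , refl) ∷
  map (λ (y , ys , e) → y , x ∷ ys , trans (swap y x refl) (prep x e)) (selections xs)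

remove : ∀ {x : A} {xs} → x ∈ xs → ∃ λ ys → x ∷ ys ↭ xs
remove {xs = _ ∷ xs} (here refl) = xs , refl
remove {x = x} {y ∷ _} (there m) with ys , e ← remove m = y ∷ ys , trans (swap x y refl) (prep y e)

-- Every search below commits to the last vertex of the path in advance: excluding it from the
-- vertices to be visited prunes the backtracking by an order of magnitude.
module Search {P : Set} {_≈_ : P → P → Set}
  (_≟_ : ∀ (p q : P) → Dec (p ≡ q)) (_≈?_ : ∀ p q → Dec (p ≈ q)) where

  adjacent? : ∀ p q → Maybe (p ≈ q)
  adjacent? p q = dec⇒maybe (p ≈? q)

  occurrence : ∀ p F → Maybe (p ∈ F)
  occurrence p []       = nothing
  occurrence p (x ∷ xs) = mapMaybe here (dec⇒maybe (p ≟ x)) <∣> mapMaybe there (occurrence p xs)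

  -- The first argument is fuel, since `ys` is not a subterm of `rem`. Callers supply the length of
  -- `rem`, so it never runs out early.
  connect : ℕ → ∀ s rem f → Maybe (Route _≈_ (s ∷ f ∷ rem) s f)
  connect _       s []          f = mapMaybe (λ s≈f → _ , s≈f ∷ [ f ] , refl) (adjacent? s f)
  connect zero    s (_ ∷ _)     f = nothing
  connect (suc n) s rem@(_ ∷ _) f = first
    (λ (y , ys , e) → adjacent? s y >>= λ s≈y →
       mapMaybe (λ (_ , path , e′) → _ , s≈y ∷ path , prep s (trans e′ (trans (swap y f refl) (prep f e))))
                (connect n y ys f))
    (selections rem)

  onward : ∀ {xs F₁} → (∃₂ λ y ys → y ∷ ys ↭ xs) → ∀ s → Maybe (∃ λ f → Route _≈_ (s ∷ xs) s f × f ∈ F₁)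
  onward {F₁ = F₁} (f , rem , e) s = occurrence f F₁ >>= λ f∈ →
    mapMaybe (λ (_ , path , e′) → f , (_ , path , trans e′ (prep s e)) , f∈) (connect (length rem) s rem f)

  greedy? : ∀ F F₁ → Maybe (Greedy _≈_ F F₁)
  greedy? F F₁ = forEach F λ s s∈ → from s (remove s∈)
    where
    from : ∀ s → (∃ λ ys → s ∷ ys ↭ F) → Maybe (∃ λ f → Route _≈_ F s f × f ∈ F₁)
    from s (ys , e) = mapMaybe (λ (f , (_ , path , e′) , f∈) → f , (_ , path , trans e′ e) , f∈)
                               (first (λ sel → onward sel s) (selections ys))

  module _ {Q : P → P → P → Set} (Q? : ∀ f q r → Maybe (Q f q r)) where

    takeoff? : ∀ f rem τ → Maybe (Takeoff _≈_ Q (f ∷ τ ∷ rem) f τ)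
    takeoff? f rem τ = first (λ (q , qs , e) → adjacent? f q >>= λ f≈q → second q qs e f≈q) (selections rem)
      where
      second : ∀ q qs → q ∷ qs ↭ rem → f ≈ q → Maybe (Takeoff _≈_ Q (f ∷ τ ∷ rem) f τ)
      -- Only `τ` is left to visit, so it serves as the third vertex `r` as well.
      second q [] e f≈q = adjacent? q τ >>= λ q≈τ →
        mapMaybe (takeoff f≈q q≈τ [ τ ] (prep f (trans (swap q τ refl) (prep τ e)))) (Q? f q τ)
      second q qs@(_ ∷ _) e f≈q = first (λ (r , rs , e′) →
        adjacent? q r >>= λ q≈r → Q? f q r >>= λ fits →
        mapMaybe (λ (_ , path , e″) → takeoff f≈q q≈r path
          (prep f (trans (prep q (trans e″ (trans (swap r τ refl) (prep τ e′))))
                         (trans (swap q τ refl) (prep τ e)))) fits)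
          (connect (length rs) r rs τ)) (selections qs)

    -- Takeoffs towards `τ` do not depend on the entry into the last fibre. They are found once, at
    -- most one for each `f`, and `land?` tries them for every `s`.
    takeoffs : ∀ {F} τ → (∃ λ ys → τ ∷ ys ↭ F) → List (∃ λ f → Takeoff _≈_ Q F f τ)
    takeoffs τ (ys , e) = List.mapMaybe (λ (f , rem , e′) →
      mapMaybe (λ { (takeoff f≈q q≈r path e″ fits) →
        f , takeoff f≈q q≈r path (trans e″ (trans (swap f τ refl) (trans (prep τ e′) e))) fits })
        (takeoff? f rem τ)) (selections ys)

    land? : ∀ {F F₀ τ} → List (∃ λ f → Takeoff _≈_ Q F₀ f τ) →
            Maybe (∀ s → s ∈ F → ∃ λ f → Route _≈_ F s f × Takeoff _≈_ Q F₀ f τ)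
    land? {F} {F₀} {τ} goals = forEach F λ s s∈ → from s (remove s∈)
      where
      from : ∀ s → (∃ λ ys → s ∷ ys ↭ F) → Maybe (∃ λ f → Route _≈_ F s f × Takeoff _≈_ Q F₀ f τ)
      from s (ys , e) = first (λ (f , t) → occurrence f ys >>= λ f∈ → to f t (remove f∈)) goals
        where
        to : ∀ f → Takeoff _≈_ Q F₀ f τ → (∃ λ zs → f ∷ zs ↭ ys) →
             Maybe (∃ λ f → Route _≈_ F s f × Takeoff _≈_ Q F₀ f τ)
        to f t (zs , e′) =
          mapMaybe (λ (_ , path , e″) → f , (_ , path , trans e″ (trans (prep s e′) e)) , t)
                   (connect (length zs) s zs f)

    closing? : ∀ Fₗ F₀ F₁ → Maybe (Closing _≈_ Q Fₗ F₀ F₁)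
    -- The takeoff ends at `τ` in `F₀` and the sweep begins at `τ` in `F₁`, so `τ` is sought in
    -- both.
    closing? Fₗ F₀ F₁ = first (λ (τ , _ , e) → occurrence τ F₀ >>= λ τ∈ →
      mapMaybe (λ h → τ , ∈-resp-↭ e (here refl) , h) (land? (takeoffs τ (remove τ∈)))) (selections F₁)

  -- Either the cut is made at the edge from `s` to `y`, and a plain Hamiltonian path remains for
  -- `connect`, or the path moves on to `y` and is cut later.
  jump : ℕ → ∀ F₁ s rem f → Maybe (Detour _≈_ (s ∷ f ∷ rem) F₁ s f)
  jump _       F₁ s []          f = occurrence s F₁ >>= λ s∈ → occurrence f F₁ >>= λ f∈ →
    mapMaybe (detour [ s ] [ f ] refl s∈ f∈) (adjacent? s f)
  jump zero    F₁ s (_ ∷ _)     f = nothing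
  jump (suc n) F₁ s rem@(_ ∷ _) f = first (λ (y , ys , e) → adjacent? s y >>= λ s≈y →
      (occurrence s F₁ >>= λ s∈ → occurrence y F₁ >>= λ y∈ →
        mapMaybe (λ (_ , path , e′) →
          detour [ s ] path (prep s (trans e′ (trans (swap y f refl) (prep f e)))) s∈ y∈ s≈y)
          (connect n y ys f))
      <∣> mapMaybe (λ { (detour before after e′ p′∈ q′∈ p′–q′) →
            detour (s≈y ∷ before) after (prep s (trans e′ (trans (swap y f refl) (prep f e))))
                   p′∈ q′∈ p′–q′ })
          (jump n F₁ y ys f))
    (selections rem)

  merge? : ∀ F F₁ → Maybe (Merge _≈_ F F₁)
  merge? F F₁ = forEach F λ p p∈ → forEach F λ q q∈ → implies (p ≈? q) λ _ → from p q (remove p∈)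
    where
    from : ∀ p q → (∃ λ ys → p ∷ ys ↭ F) → Maybe (Detour _≈_ F F₁ p q)
    from p q (ys , e) = occurrence q ys >>= λ q∈ → to (remove q∈)
      where
      to : (∃ λ zs → q ∷ zs ↭ ys) → Maybe (Detour _≈_ F F₁ p q)
      to (zs , e′) = mapMaybe (λ { (detour before after e″ p′∈ q′∈ p′–q′) →
        detour before after (trans e″ (trans (prep p e′) e)) p′∈ q′∈ p′–q′ }) (jump (length zs) F₁ p zs q)

-- Words of colours

-- A word over Fin k is followed by a further colour, which is passed separately.
Word : ℕ → Set
Word k = List (Fin k)

front : ∀ {k} → Word k → Fin k → Fin k
front []      c = c
front (x ∷ _) c = x

Chain : ∀ {k} → Word k → Fin k → Set
Chain []      c = ⊤
Chain (x ∷ w) c = x ≢ front w c × Chain w c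

chain? : ∀ {k} (w : Word k) c → Dec (Chain w c)
chain? []      c = yes tt
chain? (x ∷ w) c = ¬? (x ≟ front w c) ×-dec chain? w c

words : ∀ k → ℕ → List (Word k)
words k zero    = [] ∷ []
words k (suc r) = cartesianProductWith _∷_ (allFin k) (words k r)

-- The blocks of length r that fit in front of the colour h, respectively between a and h.
pendants : ∀ k → ℕ → Fin k → List (Word k)
pendants k r h = filter (λ p → chain? p h) (words k r)

closers : ∀ k → ℕ → Fin k × Fin k → List (Word k)
closers k r (a , h) = filter (λ p → chain? (a ∷ p) h) (words k r)

-- Storing `2 ≤ j` lets one type serve both `j = 1` and `j = 2`. In `two` the letters `y` and `y′`
-- may agree; the changed positions still lie in two consecutive ones.
data WordMove {k} (j : ℕ) : Word k → Word k → Set where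
  one   : ∀ {x x′ w} → x ≢ x′ → WordMove j (x ∷ w) (x′ ∷ w)
  two   : ∀ {x x′ y y′ w} → 2 ≤ j → x ≢ x′ → WordMove j (x ∷ y ∷ w) (x′ ∷ y′ ∷ w)
  there : ∀ {x w w′} → WordMove j w w′ → WordMove j (x ∷ w) (x ∷ w′)

_≟W_ : ∀ {k} (w w′ : Word k) → Dec (w ≡ w′)
_≟W_ = List.≡-dec _≟_

wordMove? : ∀ {k} j (w w′ : Word k) → Dec (WordMove j w w′)
wordMove? j []      _         = no λ ()
wordMove? j (_ ∷ _) []        = no λ ()
wordMove? j (x ∷ w) (x′ ∷ w′) with x ≟ x′
... | yes refl = map′ there (λ { (one x≢x) → contradiction refl x≢x
                               ; (two _ x≢x) → contradiction refl x≢x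
                               ; (there m) → m }) (wordMove? j w w′)
... | no x≢x′ with w ≟W w′
...   | yes refl = yes (one x≢x′)
...   | no w≢w′  = both w w′ w≢w′
  where
  both : ∀ w w′ → w ≢ w′ → Dec (WordMove j (x ∷ w) (x′ ∷ w′))
  both []      []        w≢ = contradiction refl w≢
  both []      (_ ∷ _)   _  = no λ { (there _) → x≢x′ refl }
  both (_ ∷ _) []        _  = no λ { (there _) → x≢x′ refl }
  both (y ∷ v) (y′ ∷ v′) w≢ = map′ (λ { (2≤j , refl) → two 2≤j x≢x′ })
    (λ { (one _) → contradiction refl w≢ ; (two 2≤j _) → 2≤j , refl
       ; (there _) → contradiction refl x≢x′ })
    (2 ℕ.≤? j ×-dec v ≟W v′)

-- Paths and cycles through the total space of a fibration

connectPaths : ∀ {x y z w xs ys} → Path R x y xs → R y z → Path R z w ys → Path R x w (xs ++ ys)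
connectPaths [ _ ]   e q = e ∷ q
connectPaths (d ∷ p) e q = d ∷ connectPaths p e q

mapPath : ∀ {R : A → A → Set} {S : B → B → Set} (g : A → B) → (∀ {x y} → R x y → S (g x) (g y)) →
          ∀ {x y xs} → Path R x y xs → Path S (g x) (g y) (map g xs)
mapPath g h [ _ ]   = [ _ ]
mapPath g h (e ∷ p) = h e ∷ mapPath g h p

-- Q is applied to the last, the first and the second vertex: it constrains the two edges at x₀.
record Cycle (R : A → A → Set) (Q : A → A → A → Set) (E : List A) : Set where
  constructor cycle
  field
    {x₀ x₁ xₗ} : A
    {xs}    : List A
    opening : R x₀ x₁
    path    : Path R x₁ xₗ xs
    closing : R xₗ x₀
    covers  : x₀ ∷ xs ↭ E
    shape   : Q xₗ x₀ x₁

mapCycle : ∀ {R : A → A → Set} {S : B → B → Set} {Q Q′ E} (g : A → B) →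
           (∀ {x y} → R x y → S (g x) (g y)) →
           (∀ {x y z} → Q x y z → Q′ (g x) (g y) (g z)) → Cycle R Q E → Cycle S Q′ (map g E)
mapCycle g h i (cycle o p c e s) = cycle (h o) (mapPath g h p) (h c) (map⁺ g e) (i s)

Within : List A → (A → A → Set) → A → A → Set
Within E R x y = x ∈ E × y ∈ E × R x y

-- `along` is demanded for every `p`, even outside the fibres. Whether a packed pair is a legitimate
-- colouring is recorded only by membership in `total`, which the constructions below keep track of.
module Fibration {X Y T P : Set} {_⇝_ : X → X → Set} {_⇝′_ : Y → Y → Set} {_≈_ : P → P → Set}
  (pack : X → P → Y) (type : X → T) (fibre : T → List P)
  (along  : ∀ {x x′} p → x ⇝ x′ → pack x p ⇝′ pack x′ p)
  (within : ∀ x {p q} → p ≈ q → pack x p ⇝′ pack x q) where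

  F : X → List P
  F x = fibre (type x)

  total : List X → List Y
  total []       = []
  total (x ∷ xs) = map (pack x) (F x) ++ total xs

  total-↭ : ∀ {xs ys} → xs ↭ ys → total xs ↭ total ys
  total-↭ refl            = refl
  total-↭ (prep x e)      = ++⁺ˡ _ (total-↭ e)
  total-↭ (swap x y e)    =
    trans (shifts (map (pack x) (F x)) (map (pack y) (F y)))
          (++⁺ˡ (map (pack y) (F y)) (++⁺ˡ (map (pack x) (F x)) (total-↭ e)))
  total-↭ (trans e e′)    = trans (total-↭ e) (total-↭ e′)

  ∈-total⁺ : ∀ {xs x p} → x ∈ xs → p ∈ F x → pack x p ∈ total xs
  ∈-total⁺ (here refl) p∈ = ∈-++⁺ˡ (∈-map⁺ _ p∈)
  ∈-total⁺ {y ∷ _} (there x∈) p∈ = ∈-++⁺ʳ (map (pack y) (F y)) (∈-total⁺ x∈ p∈)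

  ∈-total⁻ : ∀ {xs y} → y ∈ total xs → ∃₂ λ x p → x ∈ xs × p ∈ F x × y ≡ pack x p
  ∈-total⁻ {x ∷ xs} y∈ with ∈-++⁻ (map (pack x) (F x)) y∈
  ... | inj₁ y∈ˡ with p , p∈ , eq ← ∈-map⁻ _ y∈ˡ = x , p , here refl , p∈ , eq
  ... | inj₂ y∈ʳ with x′ , p , x′∈ , rest ← ∈-total⁻ y∈ʳ = x′ , p , there x′∈ , rest

  -- Injectivity of `pack` is asked only on the fibres: for edges `pack` concatenates words, and the
  -- two parts can be recovered only when the length of the block is known.
  unique-total : (∀ t → Unique (fibre t)) →
    (∀ {x x′ p p′} → p ∈ F x → p′ ∈ F x′ → pack x p ≡ pack x′ p′ → x ≡ x′ × p ≡ p′) →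
    ∀ {xs} → Unique xs → Unique (total xs)
  unique-total uF inj []              = []
  unique-total uF inj {x ∷ xs} (x∉ ∷ u) =
    Unique.++⁺ (fib (F x) (λ p∈ → p∈) (uF _)) (unique-total uF inj u) λ (y∈ˡ , y∈ʳ) → let
        p , p∈ , eq = ∈-map⁻ _ y∈ˡ
        x′ , p′ , x′∈ , p′∈ , eq′ = ∈-total⁻ y∈ʳ
      in All.lookup x∉ x′∈ (proj₁ (inj p∈ p′∈ (≡-trans (sym eq) eq′)))
    where
    fib : ∀ ps → (∀ {p} → p ∈ ps → p ∈ F x) → Unique ps → Unique (map (pack x) ps)
    fib []       _ []        = []
    fib (p ∷ ps) i (p∉ ∷ u′) =
      All.tabulate (λ y∈ eq → let q , q∈ , eq′ = ∈-map⁻ _ y∈ in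
        All.lookup p∉ q∈ (proj₂ (inj (i (here refl)) (i (there q∈)) (≡-trans eq eq′))))
      ∷ fib ps (i ∘ there) u′

  length-total : (∀ t → ∃ λ p → p ∈ fibre t) → ∀ xs → length xs ≤ length (total xs)
  length-total ne []       = z≤n
  length-total ne (x ∷ xs) rewrite List.length-++ (map (pack x) (F x)) {total xs}
    | List.length-map (pack x) (F x) with fibre (type x) | ne (type x)
  ... | _ ∷ F′ | _ = s≤s (ℕ.≤-trans (length-total ne xs) (ℕ.m≤n+m _ (length F′)))

  lift : ∀ x {p q zs} → Path _≈_ p q zs → Path _⇝′_ (pack x p) (pack x q) (map (pack x) zs)
  lift x = mapPath (pack x) (within x)

  -- The last fibre is left to `halt`, whose extra conclusion `G f` is passed through. For cycles it
  -- is the takeoff back into the fibre over the first vertex, for open paths it is trivial.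
  sweep : (∀ {x x′} → x ⇝ x′ → Greedy _≈_ (F x) (F x′)) → ∀ {x y xs} → Path _⇝_ x y xs →
    {G : P → Set} → (∀ s → s ∈ F y → ∃ λ f → Route _≈_ (F y) s f × G f) →
    ∀ s → s ∈ F x → ∃ λ f → Route _⇝′_ (total xs) (pack x s) (pack y f) × G f
  sweep greedy [ x ] halt s s∈ with f , (_ , path , e) , γ ← halt s s∈ =
    f , (_ , lift x path , trans (map⁺ _ e) (↭-reflexive (sym (List.++-identityʳ _)))) , γ
  sweep greedy {x} (x⇝x′ ∷ rest) halt s s∈
    with f , (_ , path , e) , f∈ ← greedy x⇝x′ s s∈
    with g , (_ , path′ , e′) , γ ← sweep greedy rest halt f f∈ =
    g , (_ , connectPaths (lift x path) (along f x⇝x′) path′ , ++⁺ (map⁺ _ e) e′) , γ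

  -- The cycle through a fibre is entered and left along one shared edge p′q′, so the part of the
  -- total space over the rest of the path is inserted between p′ and q′.
  merge : (∀ {x x′} → x ⇝ x′ → x′ ⇝ x) → (∀ x → Merge _≈_ (F x) (F x)) →
    (∀ {x x′} → x ⇝ x′ → Merge _≈_ (F x) (F x′)) → ∀ {x y xs} → Path _⇝_ x y xs →
    ∀ p → p ∈ F x → ∀ q → q ∈ F x → p ≈ q → Route _⇝′_ (total xs) (pack x p) (pack x q)
  merge sym⇝ last next [ x ] p p∈ q q∈ p≈q
    with detour before after e _ _ p′–q′ ← last x p p∈ q q∈ p≈q =
    _ , lift x (connectPaths before p′–q′ after) , trans (map⁺ _ e) (↭-reflexive (sym (List.++-identityʳ _)))
  merge sym⇝ last next {x} (x⇝x′ ∷ rest) p p∈ q q∈ p≈q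
    with detour {p′} {q′} {zs} {ys} before after e p′∈ q′∈ p′–q′ ← next x⇝x′ p p∈ q q∈ p≈q
    with ms , path , e′ ← merge sym⇝ last next rest p′ p′∈ q′ q′∈ p′–q′ =
    _ , connectPaths (lift x before) (along p′ x⇝x′)
          (connectPaths path (along q′ (sym⇝ x⇝x′)) (lift x after)) ,
    (begin
      map (pack x) zs ++ ms ++ map (pack x) ys   ↭⟨ ++⁺ˡ (map (pack x) zs) (++-comm ms _) ⟩
      map (pack x) zs ++ map (pack x) ys ++ ms   ≡⟨ sym (List.++-assoc (map (pack x) zs) _ ms) ⟩
      (map (pack x) zs ++ map (pack x) ys) ++ ms ≡⟨ cong (_++ ms) (sym (List.map-++ (pack x) zs ys)) ⟩
      map (pack x) (zs ++ ys) ++ ms              ↭⟨ ++⁺ (map⁺ _ e) e′ ⟩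
      _ ∎)
    where open PermutationReasoning

  -- The tour starts at the second vertex q of the route through the fibre over x₀, so that its
  -- closing edge lies in that fibre.
  close : ∀ {Q Q₀ Q₁ E} → (∀ {x x′} → x ⇝ x′ → Greedy _≈_ (F x) (F x′)) →
    (∀ {xₗ x₀ x₁} → x₀ ⇝ x₁ → Q xₗ x₀ x₁ → Closing _≈_ Q₀ (F xₗ) (F x₀) (F x₁)) →
    (∀ {xₗ x₀ x₁ f q r} → Q xₗ x₀ x₁ → Q₀ f q r → Q₁ (pack x₀ f) (pack x₀ q) (pack x₀ r)) →
    Cycle _⇝_ Q E → Cycle _⇝′_ Q₁ (total E)
  close greedy clo shape′ (cycle {x₀} {x₁} {xₗ} {xs} o path c e s)
    with τ , τ∈ , land ← clo o s
    with f , (zs , path′ , e′) , takeoff {q} {r} {ys} f–q q–r path₀ e₀ fits ← sweep greedy path land τ τ∈ =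
    cycle (within x₀ q–r)
      (connectPaths (lift x₀ path₀) (along τ o) (connectPaths path′ (along f c) [ pack x₀ f ]))
      (within x₀ f–q)
      (begin
        pack x₀ q ∷ map (pack x₀) ys ++ (zs ++ pack x₀ f ∷ [])
          ≡⟨ sym (List.++-assoc (pack x₀ q ∷ map (pack x₀) ys) zs _) ⟩
        (pack x₀ q ∷ map (pack x₀) ys ++ zs) ++ pack x₀ f ∷ []
          ↭⟨ ++-comm (pack x₀ q ∷ map (pack x₀) ys ++ zs) _ ⟩
        map (pack x₀) (f ∷ q ∷ ys) ++ zs  ↭⟨ ++⁺ (map⁺ _ e₀) e′ ⟩
        total (x₀ ∷ xs)                   ↭⟨ total-↭ e ⟩
        _ ∎)
      (shape′ s fits)
    where open PermutationReasoning

  connected : (∀ {x x′} → x ⇝ x′ → ∃ λ p → p ∈ F x × p ∈ F x′) →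
    (∀ t {p q} → p ∈ fibre t → q ∈ fibre t → p ≡ q ⊎ p ≈ q) →
    ∀ {E} → (∀ {x y} → x ∈ E → y ∈ E → Star (Within E _⇝_) x y) →
    ∀ {x y} → x ∈ total E → y ∈ total E → Star (Within (total E) _⇝′_) x y
  connected common complete {E} conn x∈ y∈
    with x , p , x∈E , p∈ , refl ← ∈-total⁻ x∈
    with y , q , y∈E , q∈ , refl ← ∈-total⁻ y∈ = go (conn x∈E y∈E) x∈E p∈ q∈
    where
    level : ∀ {x p q} → x ∈ E → p ∈ F x → q ∈ F x → Star (Within (total E) _⇝′_) (pack x p) (pack x q)
    level {x} x∈ p∈ q∈ with complete _ p∈ q∈
    ... | inj₁ refl = ε
    ... | inj₂ p≈q  = (∈-total⁺ x∈ p∈ , ∈-total⁺ x∈ q∈ , within x p≈q) ◅ ε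
    go : ∀ {x y p q} → Star (Within E _⇝_) x y → x ∈ E → p ∈ F x → q ∈ F y →
         Star (Within (total E) _⇝′_) (pack x p) (pack y q)
    go ε x∈ p∈ q∈ = level x∈ p∈ q∈
    go ((_ , x′∈ , x⇝x′) ◅ rest) x∈ p∈ q∈ with f , f∈ , f∈′ ← common x⇝x′ =
      level x∈ p∈ f∈ ◅◅ (∈-total⁺ x∈ f∈ , ∈-total⁺ x′∈ f∈′ , along f x⇝x′) ◅ go rest x′∈ f∈′ q∈

-- Moves between states

Distinct : ∀ {A : Set} → A → A → A → Set
Distinct p q r = p ≢ q × q ≢ r × p ≢ r

wordMove-sym : ∀ {k j} {w w′ : Word k} → WordMove j w w′ → WordMove j w′ w
wordMove-sym (one x≢)     = one (≢-sym x≢)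
wordMove-sym (two 2≤j x≢) = two 2≤j (≢-sym x≢)
wordMove-sym (there m)    = there (wordMove-sym m)

wordMove-++ˡ : ∀ {k j} (p : Word k) {w w′} → WordMove j w w′ → WordMove j (p ++ w) (p ++ w′)
wordMove-++ˡ []      m = m
wordMove-++ˡ (_ ∷ p) m = there (wordMove-++ˡ p m)

wordMove-++ʳ : ∀ {k j} {p q : Word k} w → WordMove j p q → WordMove j (p ++ w) (q ++ w)
wordMove-++ʳ w (one x≢)     = one x≢
wordMove-++ʳ w (two 2≤j x≢) = two 2≤j x≢
wordMove-++ʳ w (there m)    = there (wordMove-++ʳ w m)

data PointMove {A : Set} : ∀ {n} → Vec A n → Vec A n → Set where
  here  : ∀ {n x x′} {b : Vec A n} → x ≢ x′ → PointMove (x ∷ b) (x′ ∷ b)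
  there : ∀ {n x} {b b′ : Vec A n} → PointMove b b′ → PointMove (x ∷ b) (x ∷ b′)

pointMove-sym : ∀ {A : Set} {n} {b b′ : Vec A n} → PointMove b b′ → PointMove b′ b
pointMove-sym (here x≢) = here (≢-sym x≢)
pointMove-sym (there m) = there (pointMove-sym m)

pointMove-lookup : ∀ {A : Set} {n} {b b′ : Vec A n} → PointMove b b′ → ∀ u v →
                   (lookup b u ≡ lookup b′ u ⊎ lookup b v ≡ lookup b′ v) ⊎ u ≡ v
pointMove-lookup (here _)  fzero    fzero    = inj₂ refl
pointMove-lookup (here _)  (fsuc _) _        = inj₁ (inj₁ refl)
pointMove-lookup (here _)  fzero    (fsuc _) = inj₁ (inj₂ refl)
pointMove-lookup (there m) fzero    _        = inj₁ (inj₁ refl)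
pointMove-lookup (there m) (fsuc _) fzero    = inj₁ (inj₂ refl)
pointMove-lookup (there m) (fsuc u) (fsuc v) = map-⊎ id (cong fsuc) (pointMove-lookup m u v)

data OneWord {k} (j : ℕ) : ∀ {m} → Vec (Word k) m → Vec (Word k) m → Set where
  here  : ∀ {m w w′} {ws : Vec (Word k) m} → WordMove j w w′ → OneWord j (w ∷ ws) (w′ ∷ ws)
  there : ∀ {m w} {ws ws′ : Vec (Word k) m} → OneWord j ws ws′ → OneWord j (w ∷ ws) (w ∷ ws′)

oneWord-sym : ∀ {k j m} {ws ws′ : Vec (Word k) m} → OneWord j ws ws′ → OneWord j ws′ ws
oneWord-sym (here m)  = here (wordMove-sym m)
oneWord-sym (there m) = there (oneWord-sym m)

-- The colours of the vertices of the multigraph, and for every edge uv the colours of its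
-- internal vertices from u to v.
State : ℕ → ℕ → ℕ → Set
State k n m = Vec (Fin k) n × Vec (Word k) m

-- Only some of the adjacencies of the recolouring graph are modelled: a vertex of the multigraph
-- changes alone, and a pair of changing vertices lies inside one word. Spanning structures built
-- from these moves are enough.
data Move {k n m} (j : ℕ) : State k n m → State k n m → Set where
  vertex : ∀ {b b′ ws} → PointMove b b′ → Move j (b , ws) (b′ , ws)
  edge   : ∀ {b ws ws′} → OneWord j ws ws′ → Move j (b , ws) (b , ws′)

move-sym : ∀ {k n m j} {x y : State k n m} → Move j x y → Move j y x
move-sym (vertex m) = vertex (pointMove-sym m)
move-sym (edge m)   = edge (oneWord-sym m)

-- A Hamiltonian cycle without conditions at its closing edge. Merging creates a new closing edge
-- inside a single fibre, so there is no shape to remember.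
Tour : ∀ {k n m} → ℕ → List (State k n m) → Set
Tour j E = ∃₂ λ x y → Route (Move j) E x y × Move j y x

-- Colouring the vertices of the multigraph

module Vertices (k n : ℕ) = Fibration
  {Vec (Fin k) n} {Vec (Fin k) (suc n)} {⊤} {Fin k} {PointMove} {PointMove} {_≢_}
  (λ b p → p ∷ b) (λ _ → tt) (λ _ → allFin k) (λ _ → there) (λ _ → here)

vertexColourings : ∀ k n → List (Vec (Fin k) n)
vertexColourings k zero    = [] ∷ []
vertexColourings k (suc n) = Vertices.total k n (vertexColourings k n)

data Turn {A : Set} : ∀ {n} → Vec A n → Vec A n → Vec A n → Set where
  turn : ∀ {n} {c : Vec A n} {p q r} → Distinct p q r → Turn (p ∷ c) (q ∷ c) (r ∷ c)

-- A new coordinate is a fibration with constant complete fibre. The new cycle closes inside one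
-- fibre, where only this coordinate varies; asking the takeoff for three distinct colours gives
-- `Turn`.
vertexCycle : ∀ {k} → Cycle _≢_ Distinct (allFin k) → Greedy _≢_ (allFin k) (allFin k) →
  Closing _≢_ Distinct (allFin k) (allFin k) (allFin k) →
  ∀ n → Cycle PointMove Turn (vertexColourings k (suc n))
vertexCycle base _ _ zero =
  subst (Cycle _ _) (sym (List.++-identityʳ _)) (mapCycle (_∷ []) here turn base)
vertexCycle {k} base greedy closing (suc n) =
  Vertices.close k (suc n) (λ _ → greedy) (λ _ _ → closing) (λ _ → turn) (vertexCycle base greedy closing n)

-- Colouring the internal vertices of one edge

module Edge {k n m : ℕ} (j d r : ℕ) (u v : Fin n) where

  openGap : State k n m → State k n (suc m)
  openGap (b , ws) = b , [] ∷ ws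

  prepend : State k n (suc m) → Word k → State k n (suc m)
  prepend (b , w ∷ ws) p = b , (p ++ w) ∷ ws

  tip : State k n (suc m) → Fin k
  tip (b , w ∷ _) = front w (lookup b v)

  gap : State k n (suc m) → Fin k × Fin k
  gap x@(b , _) = lookup b u , tip x

  openGap-move : ∀ {x y} → Move j x y → Move j (openGap x) (openGap y)
  openGap-move (vertex m) = vertex m
  openGap-move (edge m)   = edge (there m)

  along : ∀ {x x′} p → Move j x x′ → Move j (prepend x p) (prepend x′ p)
  along {_ , _ ∷ _} p (vertex m)       = vertex m
  along             p (edge (here m))  = edge (here (wordMove-++ˡ p m))
  along             p (edge (there m)) = edge (there m)

  within : ∀ x {p q} → WordMove j p q → Move j (prepend x p) (prepend x q)
  within (_ , w ∷ _) m = edge (here (wordMove-++ʳ w m))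

  open Fibration {_⇝_ = Move j} {_⇝′_ = Move j} prepend tip (pendants k d) along within public
    using ()
    renaming (total to addPendants; total-↭ to addPendants-↭; ∈-total⁺ to ∈-addPendants⁺;
              ∈-total⁻ to ∈-addPendants⁻; unique-total to unique-addPendants;
              length-total to length-addPendants; sweep to sweepPendants; close to closePendants;
              connected to connectedPendants)
  open Fibration {_⇝_ = Move j} {_⇝′_ = Move j} prepend gap (closers k r) along within public
    using ()
    renaming (total to addClosers; total-↭ to addClosers-↭; ∈-total⁺ to ∈-addClosers⁺;
              ∈-total⁻ to ∈-addClosers⁻; unique-total to unique-addClosers;
              length-total to length-addClosers; merge to mergeClosers; close to closeClosers;
              connected to connectedClosers)

  grow : ℕ → List (State k n m) → List (State k n (suc m))
  grow zero    E = map openGap E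
  grow (suc i) E = addPendants (grow i E)

  extendEdge : ℕ → List (State k n m) → List (State k n (suc m))
  extendEdge i E = addClosers (grow i E)

-- How the colours at the two ends of the gap closed last can change in one move; they can change
-- simultaneously only on a loop.
data Step {A : Set} : A × A → A × A → Set where
  left  : ∀ {a a′ h} → Step (a , h) (a′ , h)
  right : ∀ {a h h′} → Step (a , h) (a , h′)
  both  : ∀ {a a′} → Step (a , a) (a′ , a′)

data Steady {A : Set} : A × A → A × A → Set where
  left  : ∀ {a a′ h} → Steady (a , h) (a′ , h)
  right : ∀ {a h h′} → Steady (a , h) (a , h′)

-- The ends of the gap at the three states around the closing edge of a cycle. The pattern excluded
-- is a change there and back.
data Good {A : Set} : A × A → A × A → A × A → Set where
  stay  : ∀ {t t₁} → Good t t t₁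
  left  : ∀ {h p q r} → Distinct p q r → Good (p , h) (q , h) (r , h)
  right : ∀ {a p q r} → Distinct p q r → Good (a , p) (a , q) (a , r)
  both  : ∀ {p q r} → Distinct p q r → Good (p , p) (q , q) (r , r)

-- The invariant at the closing edge between two edges of the multigraph, stated before the ends of
-- the next one are known. `turn` describes the cycle of vertex colourings, `stay` the cycle after
-- each completed edge.
data Settled {k n m} : State k n m → State k n m → State k n m → Set where
  stay : ∀ {b ws ws′ y} → Settled (b , ws) (b , ws′) y
  turn : ∀ {b b′ b″ ws ws′ ws″} → Turn b b′ b″ → Settled (b , ws) (b′ , ws′) (b″ , ws″)

-- This is `Good` read off from three blocks over one state: the left end of the gap is fixed there,
-- and the new tip is the first letter of the block.
data Heads {A : Set} : List A → List A → List A → Set where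
  same     : ∀ {x f q r} → Heads (x ∷ f) (x ∷ q) r
  distinct : ∀ {x y z f q r} → Distinct x y z → Heads (x ∷ f) (y ∷ q) (z ∷ r)

unchanged : ∀ {A : Set} {a a′ h h′ : A} → a ≡ a′ ⊎ h ≡ h′ → Steady (a , h) (a′ , h′)
unchanged (inj₁ refl) = right
unchanged (inj₂ refl) = left

steady⇒step : ∀ {A : Set} {t t′ : A × A} → Steady t t′ → Step t t′
steady⇒step left  = left
steady⇒step right = right

turn-lookup : ∀ {A : Set} {n} {x y z : Vec A n} → Turn x y z → ∀ u v →
              Good (lookup x u , lookup x v) (lookup y u , lookup y v) (lookup z u , lookup z v)
turn-lookup (turn dist) fzero    fzero    = both dist
turn-lookup (turn dist) fzero    (fsuc _) = left dist
turn-lookup (turn dist) (fsuc _) fzero    = right dist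
turn-lookup (turn _)    (fsuc _) (fsuc _) = stay

module _ {k n m j d r : ℕ} {u v : Fin n} where
  open Edge {k} {n} {m} j d r u v

  -- If the word is nonempty, its tip is a letter, so a vertex move affects at most the left end and
  -- a word move at most the right. If it is empty, both ends are vertices of the multigraph, and
  -- one vertex move changes both only on a loop.
  gap-step : ∀ {x x′} → Move j x x′ → Steady (gap x) (gap x′) ⊎ (u ≡ v × Step (gap x) (gap x′))
  gap-step (edge (here m))  = inj₁ right
  gap-step (edge (there m)) = inj₁ right
  gap-step {_ , (_ ∷ _) ∷ _} (vertex m) = inj₁ left
  gap-step {b , [] ∷ _} {b′ , _} (vertex m) with pointMove-lookup m u v
  ... | inj₁ s    = inj₁ (unchanged s)
  ... | inj₂ refl = inj₂ (refl , both)

  gap-open : ∀ {x y z} → Settled x y z → Good (gap (openGap x)) (gap (openGap y)) (gap (openGap z))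
  gap-open stay = stay
  gap-open (turn t) = turn-lookup t u v

  gap-pendants : ∀ {x f q r} → Heads f q r → Good (gap (prepend x f)) (gap (prepend x q)) (gap (prepend x r))
  gap-pendants {_ , _ ∷ _} same            = stay
  gap-pendants {_ , _ ∷ _} (distinct dist) = right dist

  settled-closers : ∀ {x f q r} → Settled (prepend x f) (prepend x q) (prepend x r)
  settled-closers {_ , _ ∷ _} = stay

  module CycleExtension
    (greedyP  : ∀ h h′ → Greedy (WordMove j) (pendants k d h) (pendants k d h′))
    (stayP    : ∀ h h′ → Closing (WordMove j) Heads (pendants k d h) (pendants k d h) (pendants k d h′))
    (turnP    : ∀ {p q r} → Distinct p q r →
                Closing (WordMove j) Heads (pendants k d p) (pendants k d q) (pendants k d r))
    (greedyC  : ∀ {t t′} → Step t t′ → Greedy (WordMove j) (closers k r t) (closers k r t′))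
    (closingC : ∀ {t t₀ t₁} → Step t₀ t₁ → Good t t₀ t₁ →
                Closing (WordMove j) (λ _ _ _ → ⊤) (closers k r t) (closers k r t₀) (closers k r t₁))
    where

    ends-step : ∀ {x x′} → Move j x x′ → Step (gap x) (gap x′)
    ends-step m with gap-step m
    ... | inj₁ s       = steady⇒step s
    ... | inj₂ (_ , s) = s

    -- Pendant blocks see only the tip. It is constant from `t` to `t₀` in the cases `stay` and
    -- `left`, and takes three distinct colours in the other two.
    closingP : ∀ {t t₀ t₁} → Good t t₀ t₁ → Closing (WordMove j) Heads
               (pendants k d (proj₂ t)) (pendants k d (proj₂ t₀)) (pendants k d (proj₂ t₁))
    closingP stay         = stayP _ _
    closingP (left _)     = stayP _ _
    closingP (right dist) = turnP dist
    closingP (both dist)  = turnP dist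

    growCycle : ∀ {E} i → Cycle (Move j) Settled E →
                Cycle (Move j) (λ x y z → Good (gap x) (gap y) (gap z)) (grow i E)
    growCycle zero    c = mapCycle openGap openGap-move gap-open c
    growCycle (suc i) c = closePendants (λ _ → greedyP _ _) (λ _ → closingP)
      (λ {_} {x₀} _ → gap-pendants {x₀}) (growCycle i c)

    extendCycle : ∀ {E} i → Cycle (Move j) Settled E → Cycle (Move j) Settled (extendEdge i E)
    extendCycle i c = closeClosers (λ m → greedyC (ends-step m)) (λ m → closingC (ends-step m))
      (λ {_} {x₀} _ _ → settled-closers {x₀}) (growCycle i c)

  module PathExtension (u≢v : u ≢ v) where

    steady : ∀ {x x′} → Move j x x′ → Steady (gap x) (gap x′)
    steady m with gap-step m
    ... | inj₁ s         = s
    ... | inj₂ (u≡v , _) = contradiction u≡v u≢v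

    growPath : (∀ h → ∃ λ p → p ∈ pendants k d h) →
               (∀ h h′ → Greedy (WordMove j) (pendants k d h) (pendants k d h′)) →
               ∀ {E} i → Tour j E → ∃₂ λ x y → Route (Move j) (grow i E) x y
    growPath some greedy zero (_ , _ , (_ , path , e) , _) =
      _ , _ , _ , mapPath openGap openGap-move path , map⁺ openGap e
    growPath some greedy {E} (suc i) c
      with x , y , _ , path , e ← growPath some greedy {E} i c
      with p , p∈ ← some (tip x)
      with _ , (_ , path′ , e′) , _ ← sweepPendants (λ _ → greedy _ _) path {λ _ → ⊤}
             (λ s s∈ → let f , route , _ = greedy _ (tip y) s s∈ in f , route , tt) p p∈ =
      _ , _ , _ , path′ , trans e′ (addPendants-↭ e)

    -- The pendant blocks need only a Hamiltonian path, because merging the closers goes out along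
    -- that path and comes back, which restores a cycle.
    extendTour : (∀ h → ∃ λ p → p ∈ pendants k d h) →
               (∀ h h′ → Greedy (WordMove j) (pendants k d h) (pendants k d h′)) →
               (∀ t → ∃₂ λ p q → p ∈ closers k r t × q ∈ closers k r t × WordMove j p q) →
               (∀ {t t′} → Steady t t′ → Merge (WordMove j) (closers k r t) (closers k r t′)) →
               ∀ {E} i → Tour j E → Tour j (extendEdge i E)
    extendTour some greedy pair merge {E} i c
      with x , y , _ , path , e ← growPath some greedy {E} i c
      with p , q , p∈ , q∈ , p≈q ← pair (gap x)
      -- `merge left` with equal left colours compares a fibre with itself. That handles the fibre
      -- at the far end of the path, where the two halves of the detour are rejoined.
      with _ , path′ , e′ ←
        mergeClosers move-sym (λ _ → merge left) (λ m → merge (steady m)) path p p∈ q q∈ p≈q =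
      _ , _ , (_ , path′ , trans e′ (addClosers-↭ e)) , within x (wordMove-sym p≈q)

    extendConnected : (∀ h h′ → ∃ λ p → p ∈ pendants k d h × p ∈ pendants k d h′) →
      (∀ h {p q} → p ∈ pendants k d h → q ∈ pendants k d h → p ≡ q ⊎ WordMove j p q) →
      (∀ {t t′} → Steady t t′ → ∃ λ p → p ∈ closers k r t × p ∈ closers k r t′) →
      (∀ t {p q} → p ∈ closers k r t → q ∈ closers k r t → p ≡ q ⊎ WordMove j p q) →
      ∀ {E} → (∀ {x y} → x ∈ E → y ∈ E → Star (Within E (Move j)) x y) →
      ∀ i {x y} → x ∈ extendEdge i E → y ∈ extendEdge i E → Star (Within (extendEdge i E) (Move j)) x y
    extendConnected commonP completeP commonC completeC {E} conn i =
      connectedClosers (λ m → commonC (steady m)) completeC (growConnected i)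
      where
      growConnected : ∀ i {x y} → x ∈ grow i E → y ∈ grow i E → Star (Within (grow i E) (Move j)) x y
      growConnected zero x∈ y∈ with _ , x∈E , refl ← ∈-map⁻ openGap x∈ | _ , y∈E , refl ← ∈-map⁻ openGap y∈ =
        gmap openGap (λ (a , b , m) → ∈-map⁺ openGap a , ∈-map⁺ openGap b , openGap-move m) (conn x∈E y∈E)
      growConnected (suc i) = connectedPendants (λ _ → commonP _ _) completeP (growConnected i)

-- The finite checks for three and four colours

distinct? : ∀ {k} (p q r : Fin k) → Dec (Distinct p q r)
distinct? p q r = ¬? (p ≟ q) ×-dec ¬? (q ≟ r) ×-dec ¬? (p ≟ r)

heads? : ∀ {k} (f q r : Word k) → Maybe (Heads f q r)
heads? (x ∷ f) (y ∷ q) (z ∷ r) with x ≟ y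
... | yes refl = just same
... | no _     = mapMaybe distinct (dec⇒maybe (distinct? x y z))
heads? _ _ _ = nothing

forDistinct : ∀ {k} {Q : Fin k → Fin k → Fin k → Set} → (∀ p q r → Maybe (Q p q r)) →
              Maybe (∀ p q r → Distinct p q r → Q p q r)
forDistinct h = forFin λ p → forFin λ q → forFin λ r → implies (distinct? p q r) λ _ → h p q r

forSteady : ∀ {k} {Q : Fin k × Fin k → Fin k × Fin k → Set} → (∀ t t′ → Maybe (Q t t′)) →
            Maybe (∀ {t t′} → Steady t t′ → Q t t′)
forSteady h = zipWith (λ l r → λ { left → l _ _ _ ; right → r _ _ _ })
  (forFin λ a → forFin λ a′ → forFin λ x → h (a , x) (a′ , x))
  (forFin λ x → forFin λ x′ → forFin λ a → h (a , x) (a , x′))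

forStep : ∀ {k} {Q : Fin k × Fin k → Fin k × Fin k → Set} → (∀ t t′ → Maybe (Q t t′)) →
          Maybe (∀ {t t′} → Step t t′ → Q t t′)
forStep h = zipWith (λ s b → λ { left → s left ; right → s right ; both → b _ _ }) (forSteady h)
  (forFin λ a → forFin λ a′ → h (a , a) (a′ , a′))

forGood : ∀ {k} {Q : Fin k × Fin k → Fin k × Fin k → Fin k × Fin k → Set} →
          (∀ t t₀ t₁ → Maybe (Q t t₀ t₁)) →
          Maybe (∀ {t t₀ t₁} → Step t₀ t₁ → Good t t₀ t₁ → Q t t₀ t₁)
forGood h = zipWith
  (λ s (l , r , b) → λ { st stay → s st ; _ (left d) → l _ _ _ _ d
                       ; _ (right d) → r _ _ _ _ d ; _ (both d) → b _ _ _ d })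
  -- `stay` leaves `t₁` free, so the move from `t₀` to `t₁` is used to restrict it to neighbours.
  (forStep λ t t₁ → h t t t₁)
  (zipWith _,_ (forFin λ x → forDistinct λ p q r → h (p , x) (q , x) (r , x))
  (zipWith _,_ (forFin λ a → forDistinct λ p q r → h (a , p) (a , q) (a , r))
               (forDistinct λ p q r → h (p , p) (q , q) (r , r))))

module _ {k j : ℕ} where
  open Search {Word k} {WordMove j} _≟W_ (wordMove? j) public
    using ()
    renaming (occurrence to occurrenceWords; greedy? to greedyWords?; merge? to mergeWords?;
              closing? to closingWords?)

module _ {k : ℕ} where
  open Search {Fin k} {_≢_} _≟_ (λ p q → ¬? (p ≟ q)) public
    using () renaming (greedy? to greedyColours?; closing? to closingColours?)

member : ∀ {A : Set} (F : List A) → Maybe (∃ λ p → p ∈ F)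
member []      = nothing
member (x ∷ _) = just (x , here refl)

edgeOf : ∀ {k} j (F : List (Word k)) → Maybe (∃₂ λ p q → p ∈ F × q ∈ F × WordMove j p q)
edgeOf j F = first (λ (p , ps , e) → first (λ (q , _ , e′) →
    mapMaybe (λ m → p , q , ∈-resp-↭ e (here refl) , ∈-resp-↭ e (there (∈-resp-↭ e′ (here refl))) , m)
             (dec⇒maybe (wordMove? j p q)))
    (selections ps))
  (selections F)

common : ∀ {k} (F F′ : List (Word k)) → Maybe (∃ λ p → p ∈ F × p ∈ F′)
common F F′ = first (λ (p , _ , e) →
    mapMaybe (λ p∈ → p , ∈-resp-↭ e (here refl) , p∈) (occurrenceWords {j = 0} p F′))
  (selections F)

complete : ∀ {k} j (F : List (Word k)) → Maybe (∀ {p q} → p ∈ F → q ∈ F → p ≡ q ⊎ WordMove j p q)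
complete j F = mapMaybe (λ h {p} {q} p∈ q∈ → h p p∈ q q∈)
  (forEach F λ p _ → forEach F λ q _ →
    mapMaybe inj₁ (dec⇒maybe (p ≟W q)) <∣> mapMaybe inj₂ (dec⇒maybe (wordMove? j p q)))

-- The searches are declared separately because from-just evaluates its argument while its type is
-- being checked: all implicit arguments must be solved by then. The results are abstract so that
-- the paths found are never unfolded.

greedyVertex₃? : Maybe (Greedy _≢_ (allFin 3) (allFin 3))
greedyVertex₃? = greedyColours? (allFin 3) (allFin 3)

greedyVertex₄? : Maybe (Greedy _≢_ (allFin 4) (allFin 4))
greedyVertex₄? = greedyColours? (allFin 4) (allFin 4)

closingVertex₃? : Maybe (Closing _≢_ Distinct (allFin 3) (allFin 3) (allFin 3))
closingVertex₃? = closingColours? (λ p q r → dec⇒maybe (distinct? p q r)) (allFin 3) (allFin 3) (allFin 3)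

closingVertex₄? : Maybe (Closing _≢_ Distinct (allFin 4) (allFin 4) (allFin 4))
closingVertex₄? = closingColours? (λ p q r → dec⇒maybe (distinct? p q r)) (allFin 4) (allFin 4) (allFin 4)

-- The blocks have two letters because one is too few for three colours: fibres over different
-- colours would share a single word, and a route through both words of a fibre that starts at the
-- shared one cannot end there.
greedyP₃? : Maybe (∀ h h′ → Greedy (WordMove 2) (pendants 3 2 h) (pendants 3 2 h′))
greedyP₃? = forFin λ h → forFin λ h′ → greedyWords? (pendants 3 2 h) (pendants 3 2 h′)

greedyP₄? : Maybe (∀ h h′ → Greedy (WordMove 1) (pendants 4 1 h) (pendants 4 1 h′))
greedyP₄? = forFin λ h → forFin λ h′ → greedyWords? (pendants 4 1 h) (pendants 4 1 h′)

stayP₃? : Maybe (∀ h h′ → Closing (WordMove 2) Heads (pendants 3 2 h) (pendants 3 2 h) (pendants 3 2 h′))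
stayP₃? = forFin λ h → forFin λ h′ → closingWords? heads? (pendants 3 2 h) (pendants 3 2 h) (pendants 3 2 h′)

turnP₃? : Maybe (∀ p q r → Distinct p q r →
  Closing (WordMove 2) Heads (pendants 3 2 p) (pendants 3 2 q) (pendants 3 2 r))
turnP₃? = forDistinct λ p q r → closingWords? heads? (pendants 3 2 p) (pendants 3 2 q) (pendants 3 2 r)

someP₃? : Maybe (∀ h → ∃ λ p → p ∈ pendants 3 2 h)
someP₃? = forFin λ h → member (pendants 3 2 h)

someP₄? : Maybe (∀ h → ∃ λ p → p ∈ pendants 4 1 h)
someP₄? = forFin λ h → member (pendants 4 1 h)

commonP₃? : Maybe (∀ h h′ → ∃ λ p → p ∈ pendants 3 1 h × p ∈ pendants 3 1 h′)
commonP₃? = forFin λ h → forFin λ h′ → common (pendants 3 1 h) (pendants 3 1 h′)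

completeP₃? : Maybe (∀ h {p q} → p ∈ pendants 3 1 h → q ∈ pendants 3 1 h → p ≡ q ⊎ WordMove 2 p q)
completeP₃? = forFin λ h → complete 2 (pendants 3 1 h)

-- Looplessness enters through `Steady`: for distinct `a` and `a′` the fibres over `(a , a)` and
-- `(a′ , a′)` have no common word of length two.
commonC₃? : Maybe (∀ {t t′} → Steady t t′ → ∃ λ p → p ∈ closers 3 2 t × p ∈ closers 3 2 t′)
commonC₃? = forSteady λ t t′ → common (closers 3 2 t) (closers 3 2 t′)

completeC₃? : Maybe (∀ a h {p q} → p ∈ closers 3 2 (a , h) → q ∈ closers 3 2 (a , h) →
  p ≡ q ⊎ WordMove 2 p q)
completeC₃? = forFin λ a → forFin λ h → complete 2 (closers 3 2 (a , h))

-- Here too `Steady` matters: for distinct `a` and `a′` the fibres over `(a , a)` and `(a′ , a′)`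
-- share only two words, each the reverse of the other, and these differ in both letters, so there
-- is no shared edge.
mergeC₄? : Maybe (∀ {t t′} → Steady t t′ → Merge (WordMove 1) (closers 4 2 t) (closers 4 2 t′))
mergeC₄? = forSteady λ t t′ → mergeWords? (closers 4 2 t) (closers 4 2 t′)

edgeC₄? : Maybe (∀ a h → ∃₂ λ p q → p ∈ closers 4 2 (a , h) × q ∈ closers 4 2 (a , h) × WordMove 1 p q)
edgeC₄? = forFin λ a → forFin λ h → edgeOf 1 (closers 4 2 (a , h))

someC₃₃? : Maybe (∀ a h → ∃ λ p → p ∈ closers 3 3 (a , h))
someC₃₃? = forFin λ a → forFin λ h → member (closers 3 3 (a , h))

someC₃₄? : Maybe (∀ a h → ∃ λ p → p ∈ closers 3 4 (a , h))
someC₃₄? = forFin λ a → forFin λ h → member (closers 3 4 (a , h))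

greedyC₃₃? : Maybe (∀ {t t′} → Step t t′ → Greedy (WordMove 2) (closers 3 3 t) (closers 3 3 t′))
greedyC₃₃? = forStep λ t t′ → greedyWords? (closers 3 3 t) (closers 3 3 t′)

greedyC₃₄? : Maybe (∀ {t t′} → Step t t′ → Greedy (WordMove 2) (closers 3 4 t) (closers 3 4 t′))
greedyC₃₄? = forStep λ t t′ → greedyWords? (closers 3 4 t) (closers 3 4 t′)

closingC₃₃? : Maybe (∀ {t t₀ t₁} → Step t₀ t₁ → Good t t₀ t₁ →
  Closing (WordMove 2) (λ _ _ _ → ⊤) (closers 3 3 t) (closers 3 3 t₀) (closers 3 3 t₁))
closingC₃₃? = forGood λ t t₀ t₁ →
  closingWords? (λ _ _ _ → just tt) (closers 3 3 t) (closers 3 3 t₀) (closers 3 3 t₁)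

closingC₃₄? : Maybe (∀ {t t₀ t₁} → Step t₀ t₁ → Good t t₀ t₁ →
  Closing (WordMove 2) (λ _ _ _ → ⊤) (closers 3 4 t) (closers 3 4 t₀) (closers 3 4 t₁))
closingC₃₄? = forGood λ t t₀ t₁ →
  closingWords? (λ _ _ _ → just tt) (closers 3 4 t) (closers 3 4 t₀) (closers 3 4 t₁)

abstract
  greedyVertex₃ : Greedy _≢_ (allFin 3) (allFin 3)
  greedyVertex₃ = from-just greedyVertex₃?

  greedyVertex₄ : Greedy _≢_ (allFin 4) (allFin 4)
  greedyVertex₄ = from-just greedyVertex₄?

  closingVertex₃ : Closing _≢_ Distinct (allFin 3) (allFin 3) (allFin 3)
  closingVertex₃ = from-just closingVertex₃?

  closingVertex₄ : Closing _≢_ Distinct (allFin 4) (allFin 4) (allFin 4)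
  closingVertex₄ = from-just closingVertex₄?

  greedyP₃ : ∀ h h′ → Greedy (WordMove 2) (pendants 3 2 h) (pendants 3 2 h′)
  greedyP₃ = from-just greedyP₃?

  greedyP₄ : ∀ h h′ → Greedy (WordMove 1) (pendants 4 1 h) (pendants 4 1 h′)
  greedyP₄ = from-just greedyP₄?

  stayP₃ : ∀ h h′ → Closing (WordMove 2) Heads (pendants 3 2 h) (pendants 3 2 h) (pendants 3 2 h′)
  stayP₃ = from-just stayP₃?

  turnP₃ : ∀ p q r → Distinct p q r →
    Closing (WordMove 2) Heads (pendants 3 2 p) (pendants 3 2 q) (pendants 3 2 r)
  turnP₃ = from-just turnP₃?

  someP₃ : ∀ h → ∃ λ p → p ∈ pendants 3 2 h
  someP₃ = from-just someP₃?

  someP₄ : ∀ h → ∃ λ p → p ∈ pendants 4 1 h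
  someP₄ = from-just someP₄?

  commonP₃ : ∀ h h′ → ∃ λ p → p ∈ pendants 3 1 h × p ∈ pendants 3 1 h′
  commonP₃ = from-just commonP₃?

  completeP₃ : ∀ h {p q} → p ∈ pendants 3 1 h → q ∈ pendants 3 1 h → p ≡ q ⊎ WordMove 2 p q
  completeP₃ = from-just completeP₃?

  commonC₃ : ∀ {t t′} → Steady t t′ → ∃ λ p → p ∈ closers 3 2 t × p ∈ closers 3 2 t′
  commonC₃ = from-just commonC₃?

  completeC₃ : ∀ a h {p q} → p ∈ closers 3 2 (a , h) → q ∈ closers 3 2 (a , h) → p ≡ q ⊎ WordMove 2 p q
  completeC₃ = from-just completeC₃?

  mergeC₄ : ∀ {t t′} → Steady t t′ → Merge (WordMove 1) (closers 4 2 t) (closers 4 2 t′)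
  mergeC₄ = from-just mergeC₄?

  edgeC₄ : ∀ a h → ∃₂ λ p q → p ∈ closers 4 2 (a , h) × q ∈ closers 4 2 (a , h) × WordMove 1 p q
  edgeC₄ = from-just edgeC₄?

  someC₃₃ : ∀ a h → ∃ λ p → p ∈ closers 3 3 (a , h)
  someC₃₃ = from-just someC₃₃?

  someC₃₄ : ∀ a h → ∃ λ p → p ∈ closers 3 4 (a , h)
  someC₃₄ = from-just someC₃₄?

  greedyC₃₃ : ∀ {t t′} → Step t t′ → Greedy (WordMove 2) (closers 3 3 t) (closers 3 3 t′)
  greedyC₃₃ = from-just greedyC₃₃?

  greedyC₃₄ : ∀ {t t′} → Step t t′ → Greedy (WordMove 2) (closers 3 4 t) (closers 3 4 t′)
  greedyC₃₄ = from-just greedyC₃₄?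

  closingC₃₃ : ∀ {t t₀ t₁} → Step t₀ t₁ → Good t t₀ t₁ →
    Closing (WordMove 2) (λ _ _ _ → ⊤) (closers 3 3 t) (closers 3 3 t₀) (closers 3 3 t₁)
  closingC₃₃ = from-just closingC₃₃?

  closingC₃₄ : ∀ {t t₀ t₁} → Step t₀ t₁ → Good t t₀ t₁ →
    Closing (WordMove 2) (λ _ _ _ → ⊤) (closers 3 4 t) (closers 3 4 t₀) (closers 3 4 t₁)
  closingC₃₄ = from-just closingC₃₄?

-- Enumerating the valid words

front-++ : ∀ {k} (p w : Word k) c → front (p ++ w) c ≡ front p (front w c)
front-++ []      w c = refl
front-++ (x ∷ p) w c = refl

chain-++⁺ : ∀ {k} (p w : Word k) c → Chain p (front w c) → Chain w c → Chain (p ++ w) c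
chain-++⁺ []      w c _         cw = cw
chain-++⁺ (x ∷ p) w c (x≢ , cp) cw = subst (x ≢_) (sym (front-++ p w c)) x≢ , chain-++⁺ p w c cp cw

chain-++⁻ : ∀ {k} (p w : Word k) c → Chain (p ++ w) c → Chain p (front w c) × Chain w c
chain-++⁻ []      w c cw       = tt , cw
chain-++⁻ (x ∷ p) w c (x≢ , cs) with cp , cw ← chain-++⁻ p w c cs =
  (subst (x ≢_) (front-++ p w c) x≢ , cp) , cw

length-take-+ : ∀ (d : ℕ) {l} (w : List A) → length w ≡ d + l → length (take d w) ≡ d
length-take-+ d w eq =
  ≡-trans (List.length-take d w) (≡-trans (cong (d ⊓_) eq) (ℕ.m≤n⇒m⊓n≡m (ℕ.m≤m+n d _)))

length-drop-+ : ∀ (d : ℕ) {l} (w : List A) → length w ≡ d + l → length (drop d w) ≡ l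
length-drop-+ d w eq = ≡-trans (List.length-drop d w) (≡-trans (cong (_∸ d) eq) (ℕ.m+n∸m≡n d _))

∈-words⁺ : ∀ {k} r (w : Word k) → length w ≡ r → w ∈ words k r
∈-words⁺ zero    []      _  = here refl
∈-words⁺ (suc r) (x ∷ w) eq = ∈-cartesianProductWith⁺ _∷_ (∈-allFin x) (∈-words⁺ r w (ℕ.suc-injective eq))

∈-words⁻ : ∀ {k} r {w : Word k} → w ∈ words k r → length w ≡ r
∈-words⁻ zero    (here refl) = refl
∈-words⁻ {k} (suc r) w∈ with _ , v , _ , v∈ , refl ← ∈-cartesianProductWith⁻ _∷_ (allFin k) (words k r) w∈ =
  cong suc (∈-words⁻ r v∈)

words-unique : ∀ k r → Unique (words k r)
words-unique k zero    = [] ∷ []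
words-unique k (suc r) =
  Unique.cartesianProductWith⁺ _∷_ List.∷-injective (Unique.allFin⁺ k) (words-unique k r)

++-injective : ∀ {A : Set} (p q : List A) {w v} → length p ≡ length q → p ++ w ≡ q ++ v → p ≡ q × w ≡ v
++-injective []      []      _  eq = refl , eq
++-injective (x ∷ p) (y ∷ q) l  eq with refl , eq′ ← List.∷-injective eq
  with refl , w≡v ← ++-injective p q (ℕ.suc-injective l) eq′ = refl , w≡v

-- Enumerating the states

∈-vertexColourings : ∀ k n (b : Vec (Fin k) n) → b ∈ vertexColourings k n
∈-vertexColourings k zero    []      = here refl
∈-vertexColourings k (suc n) (x ∷ b) = Vertices.∈-total⁺ k n (∈-vertexColourings k n b) (∈-allFin x)

vertexColourings-unique : ∀ k n → Unique (vertexColourings k n)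
vertexColourings-unique k zero    = [] ∷ []
vertexColourings-unique k (suc n) = Vertices.unique-total k n (λ _ → Unique.allFin⁺ k)
  (λ { _ _ refl → refl , refl }) (vertexColourings-unique k n)

Fits : ∀ {k} → ℕ → Fin k → Word k → Fin k → Set
Fits t a w h = length w ≡ t × Chain (a ∷ w) h

module _ {k n m j d r : ℕ} {u v : Fin n} where
  open Edge {k} {n} {m} j d r u v

  prepend-injective : ∀ {x x′ p p′} → length p ≡ length p′ → prepend x p ≡ prepend x′ p′ → x ≡ x′ × p ≡ p′
  prepend-injective {_ , _ ∷ _} {_ , _ ∷ _} {p} {p′} l eq
    with refl ← cong proj₁ eq
    with refl ← cong (Vec.tail ∘ proj₂) eq
    with refl , refl ← ++-injective p p′ l (cong (Vec.head ∘ proj₂) eq) = refl , refl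

  pendants-length : ∀ {h p} → p ∈ pendants k d h → length p ≡ d
  pendants-length p∈ = ∈-words⁻ d (proj₁ (∈-filter⁻ (λ p → chain? p _) {xs = words k d} p∈))

  closers-length : ∀ {t p} → p ∈ closers k r t → length p ≡ r
  closers-length {a , _} p∈ = ∈-words⁻ r (proj₁ (∈-filter⁻ (λ p → chain? (a ∷ p) _) {xs = words k r} p∈))

  grow-unique : ∀ {E} i → Unique E → Unique (grow i E)
  grow-unique zero    uE = Unique.map⁺ (λ { {_ , _} {_ , _} refl → refl }) uE
  grow-unique (suc i) uE = unique-addPendants
    (λ h → Unique.filter⁺ (λ p → chain? p h) (words-unique k d))
    (λ p∈ p′∈ → prepend-injective (≡-trans (pendants-length p∈) (sym (pendants-length p′∈))))
    (grow-unique i uE)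

  extendEdge-unique : ∀ {E} i → Unique E → Unique (extendEdge i E)
  extendEdge-unique i uE = unique-addClosers
    (λ (a , h) → Unique.filter⁺ (λ p → chain? (a ∷ p) h) (words-unique k r))
    (λ p∈ p′∈ → prepend-injective (≡-trans (closers-length p∈) (sym (closers-length p′∈))))
    (grow-unique i uE)

  length-extendEdge : (∀ h → ∃ λ p → p ∈ pendants k d h) → (∀ t → ∃ λ p → p ∈ closers k r t) →
                      ∀ i E → length E ≤ length (extendEdge i E)
  length-extendEdge someP someC i E = ℕ.≤-trans (length-grow i) (length-addClosers someC (grow i E))
    where
    length-grow : ∀ i → length E ≤ length (grow i E)
    length-grow zero    = ℕ.≤-reflexive (sym (List.length-map openGap E))
    length-grow (suc i) = ℕ.≤-trans (length-grow i) (length-addPendants someP (grow i E))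

  ∈-grow⁺ : ∀ {E b w ws} i → (b , ws) ∈ E → length w ≡ i * d → Chain w (lookup b v) → (b , w ∷ ws) ∈ grow i E
  ∈-grow⁺ {w = []} zero x∈ _ _ = ∈-map⁺ openGap x∈
  ∈-grow⁺ {E} {b} {w} {ws} (suc i) x∈ len ch =
    subst (λ w → (b , w ∷ ws) ∈ grow (suc i) E) (List.take++drop≡id d w)
      (∈-addPendants⁺ (∈-grow⁺ i x∈ (length-drop-+ d w len) (proj₂ split))
        (∈-filter⁺ (λ p → chain? p _) (∈-words⁺ d (take d w) (length-take-+ d w len)) (proj₁ split)))
    where
    split = chain-++⁻ (take d w) (drop d w) (lookup b v)
              (subst (λ w → Chain w (lookup b v)) (sym (List.take++drop≡id d w)) ch)

  ∈-grow⁻ : ∀ {E b w ws} i → (b , w ∷ ws) ∈ grow i E → (b , ws) ∈ E × length w ≡ i * d × Chain w (lookup b v)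
  ∈-grow⁻ zero x∈ with (_ , _) , y∈ , refl ← ∈-map⁻ openGap x∈ = y∈ , refl , tt
  ∈-grow⁻ (suc i) x∈ with (b , w ∷ ws) , p , y∈ , p∈ , refl ← ∈-addPendants⁻ x∈
    with y∈E , len , ch ← ∈-grow⁻ i y∈ =
    y∈E , ≡-trans (List.length-++ p) (cong₂ _+_ (pendants-length p∈) len) ,
    chain-++⁺ p w _ (proj₂ (∈-filter⁻ (λ p → chain? p _) {xs = words k d} p∈)) ch

  ∈-extendEdge⁺ : ∀ {E b w ws} i → (b , ws) ∈ E → Fits (r + i * d) (lookup b u) w (lookup b v) →
                  (b , w ∷ ws) ∈ extendEdge i E
  ∈-extendEdge⁺ {E} {b} {w} {ws} i x∈ (len , ch) =
    subst (λ w → (b , w ∷ ws) ∈ extendEdge i E) (List.take++drop≡id r w)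
      (∈-addClosers⁺ (∈-grow⁺ i x∈ (length-drop-+ r w len) (proj₂ split))
        (∈-filter⁺ (λ p → chain? (lookup b u ∷ p) _) (∈-words⁺ r (take r w) (length-take-+ r w len))
          (proj₁ split)))
    where
    split = chain-++⁻ (lookup b u ∷ take r w) (drop r w) (lookup b v)
              (subst (λ w → Chain (lookup b u ∷ w) (lookup b v)) (sym (List.take++drop≡id r w)) ch)

  ∈-extendEdge⁻ : ∀ {E b w ws} i → (b , w ∷ ws) ∈ extendEdge i E →
                  (b , ws) ∈ E × Fits (r + i * d) (lookup b u) w (lookup b v)
  ∈-extendEdge⁻ i x∈ with (b , w ∷ ws) , p , y∈ , p∈ , refl ← ∈-addClosers⁻ x∈
    with y∈E , len , ch ← ∈-grow⁻ i y∈ =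
    y∈E , ≡-trans (List.length-++ p) (cong₂ _+_ (closers-length p∈) len) ,
    chain-++⁺ (lookup b u ∷ p) w _
      (proj₂ (∈-filter⁻ (λ p → chain? (lookup b u ∷ p) _) {xs = words k r} p∈)) ch

-- The edge e gets r e + i e * d internal vertices.
states : ∀ (k j d : ℕ) {n m} → (Fin m → Fin n × Fin n) → (r i : Fin m → ℕ) → List (State k n m)
states k j d {n} {zero}  ends r i = map (λ b → b , []) (vertexColourings k n)
states k j d {n} {suc m} ends r i =
  Edge.extendEdge j d (r fzero) (proj₁ (ends fzero)) (proj₂ (ends fzero)) (i fzero)
    (states k j d (ends ∘ fsuc) (r ∘ fsuc) (i ∘ fsuc))

Valid : ∀ {k n m} → (Fin m → Fin n × Fin n) → (Fin m → ℕ) → State k n m → Set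
Valid ends t (b , ws) =
  ∀ e → Fits (t e) (lookup b (proj₁ (ends e))) (lookup ws e) (lookup b (proj₂ (ends e)))

module _ (k j d : ℕ) where

  states-unique : ∀ {n m} (ends : Fin m → Fin n × Fin n) r i → Unique (states k j d ends r i)
  states-unique {m = zero}  ends r i = Unique.map⁺ (cong proj₁) (vertexColourings-unique k _)
  states-unique {m = suc m} ends r i =
    extendEdge-unique {j = j} {d} {r fzero} (i fzero) (states-unique (ends ∘ fsuc) _ _)

  ∈-states⁺ : ∀ {n m} (ends : Fin m → Fin n × Fin n) r i {x} →
              Valid ends (λ e → r e + i e * d) x → x ∈ states k j d ends r i
  ∈-states⁺ {m = zero}  ends r i {b , []}     _ = ∈-map⁺ _ (∈-vertexColourings k _ b)
  ∈-states⁺ {m = suc m} ends r i {b , w ∷ ws} v = ∈-extendEdge⁺ {j = j} {d} {r fzero} (i fzero)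
    (∈-states⁺ (ends ∘ fsuc) (r ∘ fsuc) (i ∘ fsuc) (v ∘ fsuc)) (v fzero)

  ∈-states⁻ : ∀ {n m} (ends : Fin m → Fin n × Fin n) r i {x} →
              x ∈ states k j d ends r i → Valid ends (λ e → r e + i e * d) x
  ∈-states⁻ {m = suc m} ends r i {b , w ∷ ws} x∈ fzero =
    proj₂ (∈-extendEdge⁻ {j = j} {d} {r fzero} (i fzero) x∈)
  ∈-states⁻ {m = suc m} ends r i {b , w ∷ ws} x∈ (fsuc e) =
    ∈-states⁻ (ends ∘ fsuc) (r ∘ fsuc) (i ∘ fsuc)
      (proj₁ (∈-extendEdge⁻ {j = j} {d} {r fzero} (i fzero) x∈)) e

-- Letters by position, and the positions changed by a move

-- The i-th letter of w; the letter c following w is also the junk value beyond it.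
at : ∀ {k} → Word k → Fin k → ℕ → Fin k
at []      c _       = c
at (x ∷ w) c zero    = x
at (x ∷ w) c (suc i) = at w c i

at-zero : ∀ {k} (w : Word k) c → at w c 0 ≡ front w c
at-zero []      c = refl
at-zero (_ ∷ _) c = refl

at-length : ∀ {k} (w : Word k) c → at w c (length w) ≡ c
at-length []      c = refl
at-length (_ ∷ w) c = at-length w c

at-inside : ∀ {k} (w : Word k) {c c′ i} → i < length w → at w c i ≡ at w c′ i
at-inside (_ ∷ w) {i = zero}  _   = refl
at-inside (_ ∷ w) {i = suc i} i< = at-inside w (s≤s⁻¹ i<)

at-ext : ∀ {k} (w w′ : Word k) {c c′} → length w ≡ length w′ →
         (∀ {i} → i < length w → at w c i ≡ at w′ c′ i) → w ≡ w′
at-ext []      []        _ _ = refl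
at-ext (x ∷ w) (x′ ∷ w′) l h = cong₂ _∷_ (h (s≤s z≤n)) (at-ext w w′ (ℕ.suc-injective l) (h ∘ s≤s))

at-tabulate : ∀ {k t} (g : Fin t → Fin k) c (i : Fin t) → at (List.tabulate g) c (toℕ i) ≡ g i
at-tabulate g c fzero    = refl
at-tabulate g c (fsuc i) = at-tabulate (g ∘ fsuc) c i

-- At the last letter the right-hand side reads `c` itself, so the edge into the target vertex is
-- covered without a separate case.
chain-at : ∀ {k} (w : Word k) c → Chain w c → ∀ {i} → i < length w → at w c i ≢ at w c (suc i)
chain-at (x ∷ w) c (x≢ , _)  {zero}  _   = subst (x ≢_) (sym (at-zero w c)) x≢
chain-at (x ∷ w) c (_ , ch)  {suc i} i< = chain-at w c ch (s≤s⁻¹ i<)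

chain-tabulate : ∀ {k t} (g : Fin t → Fin k) c → (∀ i j → suc (toℕ i) ≡ toℕ j → g i ≢ g j) →
                 (∀ i → suc (toℕ i) ≡ t → g i ≢ c) → Chain (List.tabulate g) c
chain-tabulate {t = zero}        g c _  _  = tt
chain-tabulate {t = suc zero}    g c _  en = en fzero refl , tt
chain-tabulate {t = suc (suc t)} g c mi en = mi fzero (fsuc fzero) refl ,
  chain-tabulate (g ∘ fsuc) c (λ i j eq → mi (fsuc i) (fsuc j) (cong suc eq))
                              (λ i eq → en (fsuc i) (cong suc eq))

wordMove-at : ∀ {k j} {w w′ : Word k} c → WordMove j w w′ →
  ∃ λ i → i < length w × at w c i ≢ at w′ c i ×
    ((∀ l → at w c l ≢ at w′ c l → l ≡ i) ⊎
     (2 ≤ j × suc i < length w × (∀ l → at w c l ≢ at w′ c l → l ≡ i ⊎ l ≡ suc i)))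
wordMove-at c (one x≢) = 0 , s≤s z≤n , x≢ ,
  inj₁ λ { zero _ → refl ; (suc l) ≢ → contradiction refl ≢ }
wordMove-at c (two 2≤j x≢) = 0 , s≤s z≤n , x≢ ,
  inj₂ (2≤j , s≤s (s≤s z≤n) ,
        λ { 0 _ → inj₁ refl ; 1 _ → inj₂ refl ; (suc (suc l)) ≢ → contradiction refl ≢ })
wordMove-at c (there m) with wordMove-at c m
... | i , i< , ≢ᵢ , inj₁ only = suc i , s≤s i< , ≢ᵢ ,
  inj₁ λ { zero ≢ → contradiction refl ≢ ; (suc l) ≢ → cong suc (only l ≢) }
... | i , i< , ≢ᵢ , inj₂ (2≤j , si< , only) = suc i , s≤s i< , ≢ᵢ ,
  inj₂ (2≤j , s≤s si< ,
        λ { zero ≢ → contradiction refl ≢ ; (suc l) ≢ → map-⊎ (cong suc) (cong suc) (only l ≢) })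

oneWord-at : ∀ {k j m} {ws ws′ : Vec (Word k) m} → OneWord j ws ws′ →
  ∃ λ e → WordMove j (lookup ws e) (lookup ws′ e) × (∀ e′ → lookup ws e′ ≡ lookup ws′ e′ ⊎ e ≡ e′)
oneWord-at (here m)  = fzero , m , λ { fzero → inj₂ refl ; (fsuc _) → inj₁ refl }
oneWord-at (there m) with e , wm , only ← oneWord-at m =
  fsuc e , wm , λ { fzero → inj₁ refl ; (fsuc e′) → map-⊎ id (cong fsuc) (only e′) }

pointMove-at : ∀ {A : Set} {n} {b b′ : Vec A n} → PointMove b b′ →
  ∃ λ u → lookup b u ≢ lookup b′ u × (∀ u′ → lookup b u′ ≡ lookup b′ u′ ⊎ u ≡ u′)
pointMove-at (here x≢)  = fzero , x≢ , λ { fzero → inj₂ refl ; (fsuc _) → inj₁ refl }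
pointMove-at (there m) with u , ≢ᵤ , only ← pointMove-at m =
  fsuc u , ≢ᵤ , λ { fzero → inj₁ refl ; (fsuc u′) → map-⊎ id (cong fsuc) (only u′) }

lookup-ext : ∀ {A : Set} {n} (b b′ : Vec A n) → (∀ u → lookup b u ≡ lookup b′ u) → b ≡ b′
lookup-ext b b′ h =
  ≡-trans (sym (Vec.tabulate∘lookup b)) (≡-trans (Vec.tabulate-cong h) (Vec.tabulate∘lookup b′))

lookup-injective : ∀ {A : Set} {xs : List A} → Unique xs →
  ∀ i j → List.lookup xs i ≡ List.lookup xs j → i ≡ j
lookup-injective (x∉ ∷ u) fzero    fzero    _  = refl
lookup-injective (x∉ ∷ u) fzero    (fsuc j) eq = contradiction eq (All.lookup x∉ (∈-lookup j))
lookup-injective (x∉ ∷ u) (fsuc i) fzero    eq = contradiction (sym eq) (All.lookup x∉ (∈-lookup i))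
lookup-injective (x∉ ∷ u) (fsuc i) (fsuc j) eq = cong fsuc (lookup-injective u i j eq)

path-head : ∀ {A : Set} {R : A → A → Set} {x y zs} → Path R x y zs → ∃ λ zs′ → zs ≡ x ∷ zs′
path-head [ _ ]   = _ , refl
path-head (_ ∷ _) = _ , refl

path-last : ∀ {A : Set} {R : A → A → Set} {x y z zs} → Path R x y (z ∷ zs) →
  List.lookup (z ∷ zs) (fromℕ (length zs)) ≡ y
path-last [ _ ]         = refl
path-last (_ ∷ [ _ ])   = refl
path-last (_ ∷ (e ∷ p)) = path-last (e ∷ p)

path-consecutive : ∀ {A : Set} {R : A → A → Set} {x y z zs} → Path R x y (z ∷ zs) →
  ∀ i → R (List.lookup (z ∷ zs) (inject₁ i)) (List.lookup zs i)
path-consecutive (e ∷ [ _ ])    fzero    = e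
path-consecutive (e ∷ (_ ∷ _))  fzero    = e
path-consecutive (_ ∷ (e ∷ p))  (fsuc i) = path-consecutive (e ∷ p) i

-- Valid states as colourings of the subdivided graph

module Subdivision (M : Multigraph) (k : ℕ) (t : Fin (m M) → ℕ) (0<t : ∀ e → 0 < t e) where

  H = Subdivide M t

  source target : Fin (m M) → Fin (n M)
  source e = proj₁ (ends M e)
  target e = proj₂ (ends M e)

  colour : State k (n M) (m M) → V H → Fin k
  colour (b , ws) (inj₁ u)       = lookup b u
  colour (b , ws) (inj₂ (e , i)) = at (lookup ws e) (lookup b (target e)) (toℕ i)

  inside : ∀ {b} {ws : Vec (Word k) (m M)} → Valid (ends M) t (b , ws) → ∀ e i → toℕ i < length (lookup ws e)
  inside v e i = subst (toℕ i <_) (sym (proj₁ (v e))) (toℕ<n i)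

  proper-step : ∀ {x} → Valid (ends M) t x → ∀ {p q} → SubStep M t p q → colour x p ≢ colour x q
  proper-step {b , ws} v (start e i i≡0)
    rewrite i≡0 | at-zero (lookup ws e) (lookup b (target e)) = proj₁ (proj₂ (v e))
  proper-step {b , ws} v (mid e i l eq) rewrite sym eq =
    chain-at (lookup ws e) _ (proj₂ (proj₂ (v e))) (inside {b} {ws} v e i)
  proper-step {b , ws} v (end e i eq) agree =
    chain-at (lookup ws e) _ (proj₂ (proj₂ (v e))) (inside {b} {ws} v e i)
      (≡-trans agree (sym (≡-trans (cong (at (lookup ws e) _) (≡-trans eq (sym (proj₁ (v e)))))
                                   (at-length (lookup ws e) _))))

  colouring : ∀ {x} → Valid (ends M) t x → Colouring H k
  colouring {x} v = colour x , λ { p q (inj₁ s) → proper-step v s ; p q (inj₂ s) → proper-step v s ∘ sym }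

  state : Colouring H k → State k (n M) (m M)
  state (c , _) = Vec.tabulate (c ∘ inj₁) , Vec.tabulate λ e → List.tabulate λ i → c (inj₂ (e , i))

  state-valid : ∀ c → Valid (ends M) t (state c)
  state-valid (c , proper) e
    rewrite Vec.lookup∘tabulate (λ e → List.tabulate λ i → c (inj₂ (e , i))) e
          | Vec.lookup∘tabulate (c ∘ inj₁) (source e)
          | Vec.lookup∘tabulate (c ∘ inj₁) (target e) =
    -- `0<t` is essential here: an edge without internal vertices contributes no adjacency to
    -- `Subdivide`, whereas `Chain` would compare its two ends.
    List.length-tabulate _ , starts (0<t e) (λ i eq → proper _ _ (inj₁ (start e i eq))) ,
    chain-tabulate _ _ (λ i l eq → proper _ _ (inj₁ (mid e i l eq)))
                       (λ i eq → proper _ _ (inj₁ (end e i eq)))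
    where
    starts : ∀ {s a h} {g : Fin s → Fin k} → 0 < s →
             (∀ i → toℕ i ≡ 0 → a ≢ g i) → a ≢ front (List.tabulate g) h
    starts {suc s} _ h = h fzero refl

  colour-state : ∀ c p → colour (state c) p ≡ proj₁ c p
  colour-state (c , _) (inj₁ u) = Vec.lookup∘tabulate (c ∘ inj₁) u
  colour-state (c , _) (inj₂ (e , i))
    rewrite Vec.lookup∘tabulate (λ e → List.tabulate λ i → c (inj₂ (e , i))) e = at-tabulate _ _ i

  -- Colourings are functions compared pointwise, states are first-order data. Validity fixes the
  -- lengths of the words, so pointwise agreement becomes `≡`, and duplicates can be excluded by
  -- `Unique`.
  colour-injective : ∀ {x y} → Valid (ends M) t x → Valid (ends M) t y →
                     (∀ p → colour x p ≡ colour y p) → x ≡ y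
  colour-injective {b , ws} {b′ , ws′} v v′ h = cong₂ _,_ (lookup-ext b b′ (h ∘ inj₁))
    (lookup-ext ws ws′ λ e → at-ext (lookup ws e) (lookup ws′ e) (≡-trans (proj₁ (v e)) (sym (proj₁ (v′ e))))
      λ i< → let i<t = subst (_ <_) (proj₁ (v e)) i< in
        subst (λ l → at (lookup ws e) (lookup b (target e)) l ≡ at (lookup ws′ e) (lookup b′ (target e)) l)
              (toℕ-fromℕ< i<t) (h (inj₂ (e , fromℕ< i<t))))

  singleton-connected : ∀ p → ConnectedOn H (p ∷ [])
  singleton-connected p _ _ (here refl) (here refl) = here (here refl)

  pair-connected : ∀ {p q} → Adj H p q → Adj H q p → ConnectedOn H (p ∷ q ∷ [])
  pair-connected pq qp _ _ (here refl)         (here refl)         = here (here refl)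
  pair-connected pq qp _ _ (here refl)         (there (here refl)) =
    step (here refl) pq (here (there (here refl)))
  pair-connected pq qp _ _ (there (here refl)) (here refl)         =
    step (there (here refl)) qp (here (here refl))
  pair-connected pq qp _ _ (there (here refl)) (there (here refl)) = here (there (here refl))

  adjacent : ∀ {j} → 1 ≤ j → ∀ {x y} (v : Valid (ends M) t x) (v′ : Valid (ends M) t y) → Move j x y →
             AdjG H k j (colouring v) (colouring v′)
  adjacent 1≤j {x = b , ws} v v′ (vertex {b′ = b′} m) with u , ≢ᵤ , only ← pointMove-at m =
    (inj₁ u , ≢ᵤ) , inj₁ u ∷ [] , 1≤j , singleton-connected _ , covered
    where
    covered : ∀ p → colour (b , ws) p ≢ colour (b′ , ws) p → p ∈ inj₁ u ∷ []
    covered (inj₁ u′) ≢ with only u′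
    ... | inj₁ eq   = contradiction eq ≢
    ... | inj₂ refl = here refl
    -- The colour of the target enters `at` only beyond the end of the word, so recolouring it
    -- leaves all internal vertices alone.
    covered (inj₂ (e , i)) ≢ = contradiction (at-inside (lookup ws e) (inside {b} {ws} v e i)) ≢
  adjacent 1≤j {x = b , ws} v v′ (edge {ws′ = ws′} m) with oneWord-at m
  ... | e , wm , only with wordMove-at (lookup b (target e)) wm
  ...   | i , i< , ≢ᵢ , rest = (inj₂ (e , iF) , changed) , support rest
    where
    i<t = subst (i <_) (proj₁ (v e)) i<
    iF  = fromℕ< i<t
    w w′ : Word k
    w  = lookup ws e
    w′ = lookup ws′ e
    h = lookup b (target e)
    changed : at w h (toℕ iF) ≢ at w′ h (toℕ iF)
    changed = subst (λ l → at w h l ≢ at w′ h l) (sym (toℕ-fromℕ< i<t)) ≢ᵢ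
    Covered : List (V H) → Set
    Covered S = ∀ p → colour (b , ws) p ≢ colour (b , ws′) p → p ∈ S
    covered : ∀ {S} → (∀ (l : Fin (t e)) → at w h (toℕ l) ≢ at w′ h (toℕ l) → inj₂ (e , l) ∈ S) → Covered S
    covered f (inj₁ u) ≢ = contradiction refl ≢
    covered f (inj₂ (e′ , l)) ≢ with only e′
    ... | inj₁ eq   = contradiction (cong (λ w → at w _ (toℕ l)) eq) ≢
    ... | inj₂ refl = f l ≢
    support : _ → ∃ λ S → length S ≤ _ × ConnectedOn H S × Covered S
    support (inj₁ only′) = inj₂ (e , iF) ∷ [] , 1≤j , singleton-connected _ ,
      covered λ l ≢ → here (cong (λ l → inj₂ (e , l)) (toℕ-injective
        (≡-trans (only′ _ ≢) (sym (toℕ-fromℕ< i<t)))))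
    support (inj₂ (2≤j , si< , only′)) =
      inj₂ (e , iF) ∷ inj₂ (e , jF) ∷ [] , 2≤j , pair-connected (inj₁ ij) (inj₂ ij) , covered which
      where
      si<t = subst (suc i <_) (proj₁ (v e)) si<
      jF   = fromℕ< si<t
      ij   = mid e iF jF (≡-trans (cong suc (toℕ-fromℕ< i<t)) (sym (toℕ-fromℕ< si<t)))
      which : ∀ (l : Fin (t e)) → at w h (toℕ l) ≢ at w′ h (toℕ l) →
              inj₂ (e , l) ∈ inj₂ (e , iF) ∷ inj₂ (e , jF) ∷ []
      which l ≢ with only′ _ ≢
      ... | inj₁ eq = here (cong (λ l → inj₂ (e , l)) (toℕ-injective (≡-trans eq (sym (toℕ-fromℕ< i<t)))))
      ... | inj₂ eq = there (here (cong (λ l → inj₂ (e , l))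
        (toℕ-injective (≡-trans eq (sym (toℕ-fromℕ< si<t))))))

  -- The cycle is indexed by positions in the list: uniqueness of `E` makes the indexing injective,
  -- and completeness finds every colouring through its state.
  hamiltonian : ∀ {j} → 1 ≤ j → ∀ {E} → Unique E → (∀ {x} → x ∈ E → Valid (ends M) t x) →
    (∀ {x} → Valid (ends M) t x → x ∈ E) → 3 ≤ length E →
    ∀ {x y zs} → Path (Move j) x y zs → zs ↭ E → Move j y x → HamCycleG H k j
  hamiltonian 1≤j {E} uE sound complete 3≤ path e closing with zs , refl ← path-head path =
    length zs , f , s≤s⁻¹ (subst (3 ≤_) (sym (↭-length e)) 3≤) ,
    (λ a b eq → lookup-injective unique a b (colour-injective (valid a) (valid b) eq)) ,
    (λ d → let d∈ = ∈-resp-↭ (↭-sym e) (complete (state-valid d)) in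
       index d∈ , λ p → ≡-trans (cong (λ x → colour x p) (sym (lookup-index d∈))) (colour-state d p)) ,
    (λ i → adjacent 1≤j (valid (inject₁ i)) (valid (fsuc i)) (path-consecutive path i)) ,
    adjacent 1≤j (valid (fromℕ (length zs))) (valid fzero)
      (subst (λ y → Move _ y _) (sym (path-last path)) closing)
    where
    unique : Unique (_ ∷ zs)
    unique = Permutation.Unique-resp-↭ (setoid _) (↭⇒↭ₛ (↭-sym e)) uE
    valid : ∀ a → Valid (ends M) t (List.lookup (_ ∷ zs) a)
    valid a = sound (∈-resp-↭ e (∈-lookup a))
    f : Fin (suc (length zs)) → Colouring H k
    f a = colouring (valid a)

  connectedG : ∀ {j} → 1 ≤ j → ∀ {E} → (∀ {x} → x ∈ E → Valid (ends M) t x) →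
    (∀ {x} → Valid (ends M) t x → x ∈ E) →
    (∀ {x y} → x ∈ E → y ∈ E → Star (Within E (Move j)) x y) → ConnectedG H k j
  connectedG {j} 1≤j {E} sound complete conn c d =
    -- `c` is only pointwise equal to the colouring read back from its state, so the start of the
    -- path has to be replaced.
    before (λ p → sym (colour-state c p)) (walk (conn c∈ d∈) c∈ d∈)
    where
    c∈ = complete (state-valid c)
    d∈ = complete (state-valid d)
    walk : ∀ {x} → Star (Within E (Move j)) x (state d) → (x∈ : x ∈ E) → state d ∈ E →
           PathG H k j (colouring (sound x∈)) d
    walk ε _ _ = stop (colour-state d)
    walk ((_ , y∈ , m) ◅ rest) x∈ d∈ = move (adjacent 1≤j (sound x∈) (sound y∈) m) (walk rest y∈ d∈)
    before : ∀ {c c′ d : Colouring H k} → (∀ p → proj₁ c p ≡ proj₁ c′ p) → PathG H k j c′ d → PathG H k j c d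
    before eq (stop eq′) = stop λ p → ≡-trans (eq p) (eq′ p)
    before eq (move ((p , ≢) , S , S≤ , conS , cov) rest) =
      move ((p , ≢ ∘ ≡-trans (sym (eq p))) , S , S≤ , conS , λ q ≢ → cov q (≢ ∘ ≡-trans (eq q))) rest

-- Induction over the edges of the multigraph

colourCycle₃ : Cycle _≢_ Distinct (allFin 3)
colourCycle₃ = cycle {x₀ = fzero} (λ ()) ((λ ()) ∷ [ _ ]) (λ ()) refl ((λ ()) , (λ ()) , λ ())

colourCycle₄ : Cycle _≢_ Distinct (allFin 4)
colourCycle₄ = cycle {x₀ = fzero} (λ ()) ((λ ()) ∷ (λ ()) ∷ [ _ ]) (λ ()) refl ((λ ()) , (λ ()) , λ ())

three≤vertexColourings : ∀ k n → 3 ≤ k → 3 ≤ length (vertexColourings k (suc n))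
three≤vertexColourings k@(suc _) zero 3≤k = subst (3 ≤_) (sym card) 3≤k
  where
  card : length (vertexColourings k 1) ≡ k
  card = ≡-trans (cong length (List.++-identityʳ (map (_∷ []) (allFin k))))
    (≡-trans (List.length-map (_∷ []) (allFin k)) (List.length-tabulate {n = k} id))
three≤vertexColourings k@(suc _) (suc n) 3≤k = ℕ.≤-trans (three≤vertexColourings k n 3≤k)
  (Vertices.length-total k (suc n) (λ _ → fzero , ∈-allFin fzero) (vertexColourings k (suc n)))

-- `HamCycleG` asks for at least three vertices. Nonempty fibres never decrease the number of
-- states, so the vertex colourings already provide enough.
three≤states : ∀ {k j d} → 3 ≤ k → (∀ h → ∃ λ p → p ∈ pendants k d h) →
               ∀ {n m} (ends : Fin m → Fin (suc n) × Fin (suc n)) r i →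
               (∀ e t → ∃ λ p → p ∈ closers k (r e) t) → 3 ≤ length (states k j d ends r i)
three≤states {k} 3≤k someP {n} {zero} ends r i someC =
  subst (3 ≤_) (sym (List.length-map _ (vertexColourings k (suc n)))) (three≤vertexColourings k n 3≤k)
three≤states {j = j} {d} 3≤k someP {m = suc m} ends r i someC = ℕ.≤-trans
  (three≤states {j = j} {d} 3≤k someP (ends ∘ fsuc) (r ∘ fsuc) (i ∘ fsuc) (someC ∘ fsuc))
  (length-extendEdge {j = j} {d} {r fzero} {proj₁ (ends fzero)} {proj₂ (ends fzero)} someP
    (someC fzero) (i fzero) (states _ j d (ends ∘ fsuc) (r ∘ fsuc) (i ∘ fsuc)))

cycle₃ : ∀ {n m} (ends : Fin m → Fin (suc n) × Fin (suc n)) r i → (∀ e → r e ≡ 3 ⊎ r e ≡ 4) →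
         Cycle (Move 2) Settled (states 3 2 2 ends r i)
cycle₃ {n} {zero} ends r i _ =
  mapCycle (_, []) vertex turn (vertexCycle colourCycle₃ greedyVertex₃ closingVertex₃ n)
cycle₃ {m = suc m} ends r i r≡ with cycle₃ (ends ∘ fsuc) (r ∘ fsuc) (i ∘ fsuc) (r≡ ∘ fsuc) | r fzero | r≡ fzero
... | c | _ | inj₁ refl = CycleExtension.extendCycle {d = 2} {r = 3}
  greedyP₃ stayP₃ (turnP₃ _ _ _) greedyC₃₃ closingC₃₃ (i fzero) c
... | c | _ | inj₂ refl = CycleExtension.extendCycle {d = 2} {r = 4}
  greedyP₃ stayP₃ (turnP₃ _ _ _) greedyC₃₄ closingC₃₄ (i fzero) c

tour₄ : ∀ {n m} (ends : Fin m → Fin (suc n) × Fin (suc n)) i → (∀ e → proj₁ (ends e) ≢ proj₂ (ends e)) →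
        Tour 1 (states 4 1 1 ends (λ _ → 2) i)
tour₄ {n} {zero} ends i _ with cycle o path c e _ ← vertexCycle colourCycle₄ greedyVertex₄ closingVertex₄ n =
  _ , _ , (_ , mapPath (_, []) vertex (o ∷ path) , map⁺ _ e) , vertex c
tour₄ {m = suc m} ends i loopless =
  PathExtension.extendTour {d = 1} {r = 2} (loopless fzero) someP₄ greedyP₄
    (λ (a , h) → edgeC₄ a h) mergeC₄ (i fzero) (tour₄ (ends ∘ fsuc) (i ∘ fsuc) (loopless ∘ fsuc))

vertexColourings-connected : ∀ n {b b′} → b ∈ vertexColourings 3 n → b′ ∈ vertexColourings 3 n →
                             Star (Within (vertexColourings 3 n) PointMove) b b′
vertexColourings-connected zero (here refl) (here refl) = ε
vertexColourings-connected (suc n) = Vertices.connected 3 n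
  (λ _ → fzero , ∈-allFin {3} fzero , ∈-allFin {3} fzero)
  (λ _ {p} {q} _ _ → equal? p q) (vertexColourings-connected n)
  where
  equal? : ∀ (p q : Fin 3) → p ≡ q ⊎ p ≢ q
  equal? p q with p ≟ q
  ... | yes p≡q = inj₁ p≡q
  ... | no p≢q  = inj₂ p≢q

connected₃ : ∀ {n m} (ends : Fin m → Fin n × Fin n) i → (∀ e → proj₁ (ends e) ≢ proj₂ (ends e)) →
  ∀ {x y} → x ∈ states 3 2 1 ends (λ _ → 2) i → y ∈ states 3 2 1 ends (λ _ → 2) i →
  Star (Within (states 3 2 1 ends (λ _ → 2) i) (Move 2)) x y
connected₃ {n} {zero} ends i _ x∈ y∈
  with b , b∈ , refl ← ∈-map⁻ _ x∈
  with b′ , b′∈ , refl ← ∈-map⁻ _ y∈ =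
  gmap (_, []) (λ (x∈ , y∈ , m) → ∈-map⁺ _ x∈ , ∈-map⁺ _ y∈ , vertex m) (vertexColourings-connected n b∈ b′∈)
connected₃ {m = suc m} ends i loopless = PathExtension.extendConnected {d = 1} {r = 2}
  (loopless fzero) commonP₃ completeP₃ commonC₃ (λ (a , h) → completeC₃ a h) 
  (connected₃ (ends ∘ fsuc) (i ∘ fsuc) (loopless ∘ fsuc)) (i fzero)

-- Cutting edges into blocks, and the final assembly

-- Pendant blocks have length two, so the parity of `t` decides whether the closing block has length
-- 3 or 4.
split₃ : ∀ t → 3 ≤ t → ∃₂ λ r i → (r ≡ 3 ⊎ r ≡ 4) × t ≡ r + i * 2
split₃ (suc (suc (suc zero)))          (s≤s (s≤s (s≤s _))) = 3 , 0 , inj₁ refl , refl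
split₃ (suc (suc (suc (suc zero))))    (s≤s (s≤s (s≤s _))) = 4 , 0 , inj₂ refl , refl
split₃ (suc (suc (suc (suc (suc s))))) (s≤s (s≤s (s≤s _)))
  with r , i , r≡ , eq ← split₃ (3 + s) (s≤s (s≤s (s≤s z≤n))) =
  r , suc i , r≡ , ≡-trans (cong (2 +_) eq) (≡-trans (sym (ℕ.+-assoc 2 r _))
    (≡-trans (cong (_+ i * 2) (ℕ.+-comm 2 r)) (ℕ.+-assoc r 2 _)))

split₂ : ∀ t → 2 ≤ t → ∃ λ i → t ≡ 2 + i * 1
split₂ (suc (suc i)) (s≤s (s≤s _)) = i , cong (2 +_) (sym (ℕ.*-identityʳ i))

module _ (k j d : ℕ) {n m : ℕ} (ends : Fin m → Fin n × Fin n) {t : Fin m → ℕ}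
  (r i : Fin m → ℕ) (t≡ : ∀ e → t e ≡ r e + i e * d) where

  states-sound : ∀ {x} → x ∈ states k j d ends r i → Valid ends t x
  states-sound x∈ e with len , ch ← ∈-states⁻ k j d ends r i x∈ e = ≡-trans len (sym (t≡ e)) , ch

  states-complete : ∀ {x} → Valid ends t x → x ∈ states k j d ends r i
  states-complete v = ∈-states⁺ k j d ends r i λ e → ≡-trans (proj₁ (v e)) (t≡ e) , proj₂ (v e)

-- Without vertices there can be no edges, so the subdivision is empty and any two colourings agree.
-- This case needs the convention on complete graphs, as a single colouring admits no cycle.
empty-complete : ∀ {m ends t k j} → CompleteG (Subdivide (record { n = 0 ; m = m ; ends = ends }) t) k j
empty-complete {ends = ends} c d c≢d =
  contradiction (λ { (inj₁ ()) ; (inj₂ (e , _)) → no-ends (ends e) }) c≢d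
  where
  no-ends : ∀ {B : Set} → Fin 0 × Fin 0 → B
  no-ends ()

hamCycle₃ : ∀ {n m} (ends : Fin m → Fin (suc n) × Fin (suc n)) t r i → (∀ e → 0 < t e) →
  (∀ e → r e ≡ 3 ⊎ r e ≡ 4) → (∀ e → t e ≡ r e + i e * 2) →
  HamCycleG (Subdivide (record { n = suc n ; m = m ; ends = ends }) t) 3 2
hamCycle₃ ends t r i 0<t r≡ t≡ with cycle o path c e _ ← cycle₃ ends r i r≡ =
  Subdivision.hamiltonian _ 3 t 0<t (s≤s z≤n) (states-unique 3 2 2 ends r i)
    (states-sound 3 2 2 ends r i t≡) (states-complete 3 2 2 ends r i t≡)
    (three≤states {j = 2} ℕ.≤-refl someP₃ ends r i some)
    (o ∷ path) e c
  where
  some : ∀ e t → ∃ λ p → p ∈ closers 3 (r e) t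
  some e (a , h) with r e | r≡ e
  ... | _ | inj₁ refl = someC₃₃ a h
  ... | _ | inj₂ refl = someC₃₄ a h

hamCycle₄ : ∀ {n m} (ends : Fin m → Fin (suc n) × Fin (suc n)) t i → (∀ e → 0 < t e) →
  (∀ e → t e ≡ 2 + i e * 1) → (∀ e → proj₁ (ends e) ≢ proj₂ (ends e)) →
  HamCycleG (Subdivide (record { n = suc n ; m = m ; ends = ends }) t) 4 1
hamCycle₄ ends t i 0<t t≡ loopless with _ , _ , (_ , path , e) , c ← tour₄ ends i loopless =
  Subdivision.hamiltonian _ 4 t 0<t ℕ.≤-refl (states-unique 4 1 1 ends _ i)
    (states-sound 4 1 1 ends (λ _ → 2) i t≡) (states-complete 4 1 1 ends (λ _ → 2) i t≡)
    (three≤states {j = 1} (ℕ.n≤1+n 3) someP₄ ends _ i λ _ (a , h) →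
      let p , _ , p∈ , _ = edgeC₄ a h in p , p∈) path e c

h₃ : ∀ M t → (∀ e → 3 ≤ t e) → HamiltonianG (Subdivide M t) 3 2
h₃ record { n = zero }                _ _   = inj₁ empty-complete
h₃ record { n = suc _ ; ends = ends } t 3≤t = inj₂ (hamCycle₃ ends t (proj₁ ∘ split) (proj₁ ∘ proj₂ ∘ split)
  (λ e → ℕ.≤-trans (s≤s z≤n) (3≤t e)) (proj₁ ∘ proj₂ ∘ proj₂ ∘ split) (proj₂ ∘ proj₂ ∘ proj₂ ∘ split))
  where split = λ e → split₃ (t e) (3≤t e)

h₄ : ∀ M t → (∀ e → 2 ≤ t e) → Loopless M → HamiltonianG (Subdivide M t) 4 1
h₄ record { n = zero }                _ _   _        = inj₁ empty-complete
h₄ record { n = suc _ ; ends = ends } t 2≤t loopless = inj₂ (hamCycle₄ ends t (proj₁ ∘ split)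
  (λ e → ℕ.≤-trans (s≤s z≤n) (2≤t e)) (proj₂ ∘ split) loopless)
  where split = λ e → split₂ (t e) (2≤t e)

g₃ : ∀ M t → (∀ e → 2 ≤ t e) → Loopless M → ConnectedG (Subdivide M t) 3 2
g₃ M t 2≤t loopless = Subdivision.connectedG M 3 t (λ e → ℕ.≤-trans (s≤s z≤n) (2≤t e)) (s≤s z≤n)
  (states-sound 3 2 1 (ends M) (λ _ → 2) _ (proj₂ ∘ split))
  (states-complete 3 2 1 (ends M) (λ _ → 2) _ (proj₂ ∘ split))
  (connected₃ (ends M) (proj₁ ∘ split) loopless)
  where split = λ e → split₂ (t e) (2≤t e)

mainTheorem3 : (M : Multigraph) (ℓ : ℕ) (t : Fin (m M) → ℕ) → (∀ e → ℓ ≤ t e) →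
    ((ℓ ≡ 2 → Loopless M → g≤ (Subdivide M t) 3 2 × h≡1 (Subdivide M t) 4) ×
    (ℓ ≡ 3 → h≤ (Subdivide M t) 3 2))
mainTheorem3 M ℓ t ℓ≤t =
  (λ { refl loopless → (2 , s≤s z≤n , ℕ.≤-refl , g₃ M t ℓ≤t loopless) , h₄ M t ℓ≤t loopless }) ,
  (λ { refl → 2 , s≤s z≤n , ℕ.≤-refl , h₃ M t ℓ≤t })
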